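{- Let $\mathbf H$ be a finite connected ordered hypergraph and let $S,T$ be constructs of $\mathbf H$. If $S\leq_{\mathit{GFO}}T$ (generalised flip order), then $S\leq_{\mathit{FWO}}T$ (facial weak order).
   Context: A (finite) hypergraph $\mathbf H$ with finite vertex set $H$ is a set of non-empty subsets of $H$ (hyperedges) with $\bigcup\mathbf H=H$ and $\{x\}\in\mathbf H$ for all $x\in H$. For $X\subseteq H$, $\mathbf H_X:=\{Z\in\mathbf H: Z\subseteq X\}$ and $\mathbf H\setminus X:=\mathbf H_{H\setminus X}$. $\mathbf H$ is connected if there is no partition $H=X_1\cup X_2$ into two non-empty parts with $\mathbf H=\mathbf H_{X_1}\cup\mathbf H_{X_2}$. $\mathbf H,X\leadsto H_1,\dots,H_n$ means that $\mathbf H_{H_1},\dots,\mathbf H_{H_n}$ are the connected components of $\mathbf H\setminus X$. Constructs of a connected hypergraph $\mathbf H$ are non-planar rooted trees with nodes labelled by non-empty subsets of $H$, defined recursively: the one-node tree labelled $H$ is a construct of $\mathbf H$; if $\emptyset\neq Y\subsetneq H$, $\mathbf H,Y\leadsto H_1,\dots,H_n$, and $T_i$ is a construct of $\mathbf H_{H_i}$ for each $i$, then the tree $Y(T_1,\dots,T_n)$ with root $Y$ and immediate subtrees $T_1,\dots,T_n$ is a construct of $\mathbf H$. Nodes are identified with their labels. A construction is a construct all of whose nodes are singletons. $\mathbf H$ is ordered if $H$ carries a total order; $Y<Z$ (or $Z>Y$) means $\max Y<\min Z$. If in a construct $S$ the node $X$ is the parent of the node $Y$, contracting the edge between them and labelling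 the merged node $X\cup Y$ yields a construct $T$; write $S\subset_{X,Y}T$, and say that $S$ is a facet of $T$. $S\subseteq T$ means that $T$ is obtained from $S$ by a (possibly empty) sequence of edge contractions. Generalised flip order: $S\lessdot S'$ iff there exist $U,V$ with $U>V$ such that either $S\subset_{U,V}S'$ (fusion) or $S'\subset_{V,U}S$ (split); $\leq_{\mathit{GFO}}$ is the reflexive and transitive closure of $\lessdot$. Flip order: let $S$ be a construction of $\mathbf H$ with $\{x\}$ the parent of $\{y\}$ and $y<x$. Let $G$ be the union of the labels of $\{x\}$ and all its descendants in $S$, and $\mathbf G=\mathbf H_G$. The subtree of $S$ rooted at $\{x\}$ consists of $x$, its child $y$, and, for each connected component $C$ of $\mathbf G\setminus\{x,y\}$, a construction $S_C$ of $\mathbf G_C$. $\mathsf{Flip}_S(x,y)$ is obtained from $S$ by replacing this subtree with the one having root $\{y\}$, whose children are: a node $\{x\}$, carrying as immediate subtrees those $S_C$ with $C$ contained in the component of $\mathbf G\setminus\{y\}$ containing $x$; and all the remaining $S_C$. The flip order $\le_{\mathrm{flip}}$ is the partial order on constructions that is the reflexive transitive closure of the relation $S\mapsto\mathsf{Flip}_S(x,y)$ (so $S\le_{\mathrm{flip}}\mathsf{Flip}_S(x,y)$). Facial weak order: for a construct $S$, let $\max\{S\}$ and $\min\{S\}$ be the maximum and minimum, for $\le_{\mathrm{flip}}$, of the set of constructions $T$ with $T\subseteq S$. Write $S\lessdot_{\mathit{FWO}}T$ iff either $S$ is a facet of $T$, $\min\{S\}=\min\{T\}$ and $\max\{S\}<_{\mathrm{flip}}\max\{T\}$;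 or $T$ is a facet of $S$, $\max\{S\}=\max\{T\}$ and $\min\{S\}<_{\mathrm{flip}}\min\{T\}$. Then $\leq_{\mathit{FWO}}$ is the reflexive and transitive closure of $\lessdot_{\mathit{FWO}}$. -}

module Defs where

open import Data.Fin using (Fin; _≤_; _<_)
open import Data.Fin.Subset as Subset
  using (Subset; inside; outside; _∈_; _⊆_; Nonempty; _∪_; _─_; ⁅_⁆)
open import Data.Fin.Subset.Properties using (anySubset?; nonempty?; _⊆?_)
open import Data.List.Base using (List; []; _∷_; filter; cartesianProductWith)
import Data.List.Membership.Propositional as List
open import Data.List.Relation.Unary.All as All using (All)
open import Data.Nat.Base using (ℕ; zero; suc)
open import Data.Product using (∃; ∃₂; ∃-syntax; _×_; _,_; map₂)
open import Data.Sum using (_⊎_)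
open import Data.Vec.Base as Vec using ()
open import Function.Base using (flip)
open import Function.Bundles using (_⇔_)
open import Level using (Level; 0ℓ; _⊔_)
open import Relation.Binary.Core using (Rel)
open import Relation.Binary.Construct.Closure.ReflexiveTransitive using (Star)
open import Relation.Binary.PropositionalEquality using (_≡_; _≢_)
open import Relation.Nullary using (¬_; Dec; yes; no; ¬?; _×-dec_; _⊎-dec_; _→-dec_)
open import Relation.Nullary.Decidable using (map′; decidable-stable)
open import Relation.Unary as Pred using (Pred; Decidable; _≐_)

private
  variable
    a p ℓ : Level
    n : ℕ

-- An ordered hypergraph: the totally ordered finite vertex set is Fin n.
-- That the hyperedges cover the vertex set is a consequence of `singleton`.

record Hypergraph (n : ℕ) : Set₁ where
  field
    Edge      : Pred (Subset n) 0ℓ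
    edge?     : Decidable Edge
    nonempty  : ∀ {Z} → Edge Z → Nonempty Z
    singleton : ∀ x → Edge ⁅ x ⁆

open Hypergraph public

infixl 5 _↾_
infix 4 _≺_

-- H ↾ X is H_X.  Since singletons are hyperedges, the vertex set of H_X
-- is X; so below H_X is always given by the pair of H and X, and
-- H_X ∖ Y is H ↾ (X ─ Y).

_↾_ : Hypergraph n → Subset n → Pred (Subset n) 0ℓ
(H ↾ X) Z = Edge H Z × Z ⊆ X

Splits : Hypergraph n → Subset n → Subset n → Set
Splits H X A = A ⊆ X × (H ↾ X) ≐ ((H ↾ A) Pred.∪ (H ↾ (X ─ A)))

Connected : Hypergraph n → Subset n → Set
Connected H X = ¬ (∃[ A ] Nonempty A × Nonempty (X ─ A) × Splits H X A)

-- H_C is a block of the decomposition H_X = H_{X₁} ∪ … ∪ H_{Xₘ}, where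
-- the Xᵢ are disjoint and non-empty and each H_{Xᵢ} is connected.

Component : Hypergraph n → Subset n → Pred (Subset n) 0ℓ
Component H X C = Nonempty C × Connected H C × Splits H X C

allSubsets? : {P : Pred (Subset n) ℓ} → Decidable P → Dec (∀ {Z} → P Z)
allSubsets? P? = map′
  (λ ∄ {Z} → decidable-stable (P? Z) λ ¬p → ∄ (Z , ¬p))
  (λ all (_ , ¬p) → ¬p all)
  (¬? (anySubset? λ Z → ¬? (P? Z)))

edge↾? : (H : Hypergraph n) (X : Subset n) → Decidable (H ↾ X)
edge↾? H X Z = edge? H Z ×-dec (Z ⊆? X)

splits? : (H : Hypergraph n) (X : Subset n) → Decidable (Splits H X)
splits? H X A =
  (A ⊆? X) ×-dec
  allSubsets? (λ Z → whole? Z →-dec parts? Z) ×-dec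
  allSubsets? (λ Z → parts? Z →-dec whole? Z)
  where
  whole? = edge↾? H X
  parts? = λ Z → edge↾? H A Z ⊎-dec edge↾? H (X ─ A) Z

connected? : (H : Hypergraph n) → Decidable (Connected H)
connected? H X = ¬? (anySubset? λ A →
  nonempty? A ×-dec nonempty? (X ─ A) ×-dec splits? H X A)

component? : (H : Hypergraph n) (X : Subset n) → Decidable (Component H X)
component? H X C = nonempty? C ×-dec connected? H C ×-dec splits? H X C

subsets : ∀ n → List (Subset n)
subsets zero    = Vec.[] ∷ []
subsets (suc n) = cartesianProductWith Vec._∷_ (inside ∷ outside ∷ []) (subsets n)

components : Hypergraph n → Subset n → List (Subset n)
components {n} H X = filter (component? H X) (subsets n)

-- Construct H X is the type of constructs of H_X.  The immediate subtrees
-- are a family indexed by the components, each of which `components` lists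
-- once, in an order that depends only on X and Y; so propositional equality
-- is equality of non-planar trees.  The one-node tree is the case Y ≡ X,
-- in which there are no components.

data Construct (H : Hypergraph n) (X : Subset n) : Set where
  node : (Y : Subset n) → .(Nonempty Y) → .(Y ⊆ X) →
         All (Construct H) (components H (X ─ Y)) → Construct H X

IsMaximum : {A : Set a} → Rel A ℓ → Pred A p → Pred A (a ⊔ ℓ ⊔ p)
IsMaximum _≼_ P x = P x × (∀ {y} → P y → y ≼ x)

IsMinimum : {A : Set a} → Rel A ℓ → Pred A p → Pred A (a ⊔ ℓ ⊔ p)
IsMinimum _≼_ = IsMaximum (flip _≼_)

_≺_ : Rel (Subset n) 0ℓ
Y ≺ Z = ∃₂ λ y z → IsMaximum _≤_ (_∈ Y) y × IsMinimum _≤_ (_∈ Z) z × y < z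

module _ {H : Hypergraph n} where

  infix 4 _◁_ _⊂[_,_]_ _FacetOf_ _⊑_ _⋖GFO_ _≤GFO_ _⋖flip_ _≤flip_ _<flip_ _⋖FWO_ _≤FWO_

  private
    variable
      C D K X : Subset n

  label : Construct H X → Subset n
  label (node Y _ _ _) = Y

  -- t ◁ S: t is an immediate subtree of S.  Its support D, the union of
  -- its labels, determines it, so `D ≢ C` below excludes one subtree.

  _◁_ : Construct H D → Construct H X → Set
  _◁_ {D} {X} t (node Y _ _ ts) =
    ∃ λ (D∈ : D List.∈ components H (X ─ Y)) → All.lookup ts D∈ ≡ t

  data NodeOf (Z : Subset n) (S : Construct H X) : Set where
    root  : label S ≡ Z → NodeOf Z S
    below : {P : Construct H D} → P ◁ S → NodeOf Z P → NodeOf Z S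

  IsConstruction : Construct H X → Set
  IsConstruction S = ∀ {Z} → NodeOf Z S → ∃[ x ] Z ≡ ⁅ x ⁆

  -- t is an immediate subtree of the tree obtained by contracting the edge
  -- between the root of S and the root of its immediate subtree P.

  Remains : Construct H X → Construct H C → Construct H D → Set
  Remains {C = C} {D = D} S P t = (t ◁ S × D ≢ C) ⊎ t ◁ P

  record RootContraction (U V : Subset n) (S T : Construct H X) : Set where
    field
      {support} : Subset n
      child     : Construct H support
      child◁    : child ◁ S
      labelS    : label S ≡ U
      labelP    : label child ≡ V
      labelT    : label T ≡ U ∪ V
      subtrees  : ∀ {D} (t : Construct H D) → t ◁ T ⇔ Remains S child t

  -- {x} is the root of S and {y} that of child, while {x} is the root of
  -- child′ in S′.  The subtrees S_K are the t with Remains S child t.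

  record RootFlip (x y : Fin n) (S S′ : Construct H X) : Set where
    field
      {support support′} : Subset n
      child   : Construct H support
      child◁  : child ◁ S
      labelS  : label S ≡ ⁅ x ⁆
      labelP  : label child ≡ ⁅ y ⁆
      child′  : Construct H support′
      child′◁ : child′ ◁ S′
      x∈      : x ∈ support′
      labelS′ : label S′ ≡ ⁅ y ⁆
      labelP′ : label child′ ≡ ⁅ x ⁆
      inner   : ∀ {K} (t : Construct H K) →
                t ◁ child′ ⇔ (Remains S child t × K ⊆ support′)
      outer   : ∀ {K} (t : Construct H K) →
                (t ◁ S′ × K ≢ support′) ⇔ (Remains S child t × ¬ K ⊆ support′)

  -- T results from S by replacing one subtree by an R-related one.

  data Replace (R : ∀ {D} → Rel (Construct H D) 0ℓ) (S T : Construct H X) : Set where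
    here  : R S T → Replace R S T
    there : {P Q : Construct H C} → label S ≡ label T → P ◁ S → Q ◁ T →
            (∀ {D} (t : Construct H D) → D ≢ C → t ◁ S ⇔ t ◁ T) →
            Replace R P Q → Replace R S T

  _⊂[_,_]_ : Construct H X → Subset n → Subset n → Construct H X → Set
  S ⊂[ U , V ] T = Replace (RootContraction U V) S T

  _FacetOf_ : Rel (Construct H X) 0ℓ
  S FacetOf T = ∃₂ λ U V → S ⊂[ U , V ] T

  _⊑_ : Rel (Construct H X) 0ℓ
  _⊑_ = Star _FacetOf_

  _⋖GFO_ : Rel (Construct H X) 0ℓ
  S ⋖GFO S′ = ∃₂ λ U V → V ≺ U × (S ⊂[ U , V ] S′ ⊎ S′ ⊂[ V , U ] S)

  _≤GFO_ : Rel (Construct H X) 0ℓ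
  _≤GFO_ = Star _⋖GFO_

  -- Steps start (hence also end) at constructions.

  _⋖flip_ : Rel (Construct H X) 0ℓ
  S ⋖flip S′ = IsConstruction S × ∃₂ λ x y → y < x × Replace (RootFlip x y) S S′

  _≤flip_ : Rel (Construct H X) 0ℓ
  _≤flip_ = Star _⋖flip_

  _<flip_ : Rel (Construct H X) 0ℓ
  S <flip T = S ≤flip T × S ≢ T

  ConstructionIn : Construct H X → Pred (Construct H X) 0ℓ
  ConstructionIn S T = IsConstruction T × T ⊑ S

  -- M is max{S}, respectively m is min{S}.

  IsMax : Construct H X → Pred (Construct H X) 0ℓ
  IsMax S M = IsMaximum _≤flip_ (ConstructionIn S) M

  IsMin : Construct H X → Pred (Construct H X) 0ℓ
  IsMin S m = IsMinimum _≤flip_ (ConstructionIn S) m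

  SameMax SameMin MaxIncreases MinIncreases : Rel (Construct H X) 0ℓ
  SameMax S T = ∃[ M ] IsMax S M × IsMax T M
  SameMin S T = ∃[ m ] IsMin S m × IsMin T m
  MaxIncreases S T = ∃₂ λ M M′ → IsMax S M × IsMax T M′ × M <flip M′
  MinIncreases S T = ∃₂ λ m m′ → IsMin S m × IsMin T m′ × m <flip m′

  _⋖FWO_ : Rel (Construct H X) 0ℓ
  S ⋖FWO T = (S FacetOf T × SameMin S T × MaxIncreases S T)
           ⊎ (T FacetOf S × SameMax S T × MinIncreases S T)

  _≤FWO_ : Rel (Construct H X) 0ℓ
  _≤FWO_ = Star _⋖FWO_

{-# OPTIONS --safe #-}
module Submission where

-- A construct S is determined by the map sending each connected set K to the
-- root `top S K` of the restriction of S to K.  Contracting an edge U – V only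
-- replaces U ∩ K by (U ∪ V) ∩ K for some K, and every refinement of S has
-- smaller tops.  The extremal constructions min{S} and max{S} are obtained by
-- always cutting off the greatest, respectively the least, element of
-- `top S K`.  Hence fusing a node U with a child V < U leaves min{S}
-- unchanged, as the greatest element of (U ∪ V) ∩ K lies in U as soon as U
-- meets K, but alters max{S}, which increases because S refines the result;
-- a split is the same with the order reversed.

import Data.Bool.Properties as Bool
open import Data.Empty using (⊥-elim; ⊥-elim-irr)
open import Data.Fin using (Fin; _≤_; _<_)
import Data.Fin.Properties as Fin
open import Data.Fin.Subset
  using (Subset; inside; outside; _∈_; _∉_; _⊆_; Nonempty; _∩_; _∪_; _─_; ⁅_⁆; ∣_∣; ⊤)
open import Data.Fin.Subset.Properties
open import Data.List.Base using ([]; _∷_)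
import Data.List.Membership.Propositional as List
open import Data.List.Membership.Propositional.Properties
  using (∈-filter⁺; ∈-filter⁻; ∈-cartesianProductWith⁺)
open import Data.List.Membership.Propositional.Properties.WithK using (unique⇒irrelevant)
open import Data.List.Relation.Unary.All as All using (All; []; _∷_)
open import Data.List.Relation.Unary.AllPairs using ([]; _∷_)
open import Data.List.Relation.Unary.Any using (here; there)
open import Data.List.Relation.Unary.Unique.Propositional using (Unique)
import Data.List.Relation.Unary.Unique.Propositional.Properties as Unique
open import Data.Nat.Base as ℕ using (ℕ; zero; suc)
import Data.Nat.Properties as ℕ
open import Data.Product using (∃; ∃₂; ∃-syntax; _×_; _,_; proj₁; proj₂)
open import Data.Sum as Sum using (_⊎_; inj₁; inj₂)
open import Data.Vec.Base as Vec using ()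
import Data.Vec.Properties as Vec
open import Function.Base using (_∘_; id; flip; case_of_)
open import Function.Bundles using (_⇔_; mk⇔; Equivalence)
open import Level using (0ℓ)
open import Relation.Binary.Core using (Rel)
open import Relation.Binary.Construct.Closure.ReflexiveTransitive
  using (Star; ε; _◅_; _◅◅_; gmap; return)
open import Relation.Binary.PropositionalEquality
open import Relation.Binary.Structures using (IsDecTotalOrder)
import Relation.Binary.Construct.Flip.EqAndOrd as Flip
open import Relation.Nullary using (¬_; Dec; yes; no; contradiction; recompute; _×-dec_; _→-dec_; does)
open import Relation.Nullary.Decidable using (map′; dec-true)
open import Relation.Unary using (Decidable)
open import Defs

-- `IsMax` and `IsMin` carry no existence statement, so the extremal constructions have to be built,
-- and every construction refining S has to be joined to them by flips. Surgery on trees whose types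
-- depend on their supports would make this unwieldy. Trees are therefore generated by choice
-- functions on all subsets, and a flip becomes a local change of such a function. Consistency is
-- what allows a choice to be read back off its tree. The trees passed through on the way to an
-- extremal construction come from choices modified by hand, of which only `Chooses` is demanded.
-- One argument for an arbitrary total order covers both extrema.

private
  variable
    n : ℕ
    x y z : Fin n
    A B C D K L U V X Y Z : Subset n

-- Finite subsets and their enumeration.

x∈p─q⇒x∉q : ∀ (p q : Subset n) → x ∈ p ─ q → x ∉ q
x∈p─q⇒x∉q (_ Vec.∷ p) (outside Vec.∷ q) (Vec.there x∈) (Vec.there x∈q) = x∈p─q⇒x∉q p q x∈ x∈q
x∈p─q⇒x∉q (_ Vec.∷ p) (inside Vec.∷ q) (Vec.there x∈) (Vec.there x∈q) = x∈p─q⇒x∉q p q x∈ x∈q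

─⊆ : X ─ A ⊆ X
─⊆ {X = X} {A} = p─q⊆p X A

∈─⇒∉ : x ∈ X ─ A → x ∉ A
∈─⇒∉ {X = X} {A} = x∈p─q⇒x∉q X A

∩⁻ : x ∈ A ∩ B → x ∈ A × x ∈ B
∩⁻ {A = A} {B} = x∈p∩q⁻ A B

─-monoˡ-⊆ : A ⊆ B → A ─ C ⊆ B ─ C
─-monoˡ-⊆ A⊆B x∈ = x∈p∧x∉q⇒x∈p─q (A⊆B (─⊆ x∈)) (∈─⇒∉ x∈)

∣─∣< : A ⊆ X → Nonempty A → ∣ X ─ A ∣ ℕ.< ∣ X ∣
∣─∣< A⊆X (a , a∈) = p∩q≢∅⇒∣p─q∣<∣p∣ _ _ (a , x∈p∩q⁺ (A⊆X a∈ , a∈))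

singleton⊆ : x ∈ A → ⁅ x ⁆ ⊆ A
singleton⊆ {x = x} x∈ z∈ with refl ← x∈⁅y⁆⇒x≡y x z∈ = x∈

_≟ˢ_ : (A B : Subset n) → Dec (A ≡ B)
_≟ˢ_ = Vec.≡-dec Bool._≟_

singleton-∩ : x ∈ K → ⁅ x ⁆ ∩ K ≡ ⁅ x ⁆
singleton-∩ x∈K = ⊆-antisym (proj₁ ∘ ∩⁻) λ z∈ → x∈p∩q⁺ (z∈ , singleton⊆ x∈K z∈)

≺⇒< : V ≺ U → x ∈ U → y ∈ V → y < x
≺⇒< (_ , _ , (_ , ≤v) , (_ , u≤) , v<u) x∈U y∈V =
  ℕ.<-≤-trans (ℕ.≤-<-trans (≤v y∈V) v<u) (u≤ x∈U)

<⇒≪ : ∀ {x y : Fin n} → x < y → x ≤ y × x ≢ y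
<⇒≪ x<y = ℕ.<⇒≤ x<y , Fin.<⇒≢ x<y

<⇒≫ : ∀ {x y : Fin n} → x < y → x ≤ y × y ≢ x
<⇒≫ x<y = ℕ.<⇒≤ x<y , Fin.<⇒≢ x<y ∘ sym

∈-subsets : ∀ (Z : Subset n) → Z List.∈ subsets n
∈-subsets Vec.[] = here refl
∈-subsets (s Vec.∷ Z) =
  ∈-cartesianProductWith⁺ Vec._∷_ {xs = inside ∷ outside ∷ []} (side s) (∈-subsets Z)
  where
  side : ∀ s → s List.∈ inside ∷ outside ∷ []
  side inside = here refl
  side outside = there (here refl)

subsets-unique : ∀ n → Unique (subsets n)
subsets-unique zero = [] ∷ []
subsets-unique (suc n) = Unique.cartesianProductWith⁺ Vec._∷_ Vec.∷-injective
  (((λ ()) ∷ []) ∷ [] ∷ []) (subsets-unique n)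

size-induction : (P : Subset n → Set) →
                 (∀ X → (∀ {K} → ∣ K ∣ ℕ.< ∣ X ∣ → P K) → P X) → ∀ X → P X
size-induction P step X = go (suc ∣ X ∣) X ℕ.≤-refl
  where
  go : ∀ k X → ∣ X ∣ ℕ.< k → P X
  go (suc k) X X<k = step X λ {K} K<X → go k K (ℕ.≤-trans K<X (ℕ.s≤s⁻¹ X<k))

-- Least elements for an arbitrary decidable total order.

module _ {_≼_ : Rel (Fin n) 0ℓ} (O : IsDecTotalOrder _≡_ _≼_) where

  private
    module O = IsDecTotalOrder O

    First : Subset n → Fin n → Set
    First A = IsMinimum _≼_ (_∈ A)

    first? : ∀ A → Decidable (First A)
    first? A x = (x ∈? A) ×-dec
      map′ (λ f {z} → f z) (λ f z → f) (Fin.all? λ z → (z ∈? A) →-dec (x O.≤? z))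

  -- {min A} for the order O, and ∅ if A is empty.
  firsts : Subset n → Subset n
  firsts A = Vec.tabulate λ x → does (first? A x)

  ∈-firsts⁺ : IsMinimum _≼_ (_∈ A) x → x ∈ firsts A
  ∈-firsts⁺ {A = A} {x} p =
    Vec.lookup⇒[]= x _ (trans (Vec.lookup∘tabulate _ x) (dec-true (first? A x) p))

  ∈-firsts⁻ : x ∈ firsts A → IsMinimum _≼_ (_∈ A) x
  ∈-firsts⁻ {x = x} {A} x∈ with first? A x in eq
  ... | yes p = p
  ... | no _ with () ← trans (sym (trans (Vec.lookup∘tabulate _ x) (cong does eq))) (Vec.[]=⇒lookup x∈)

  firsts-⊆ : firsts A ⊆ A
  firsts-⊆ x∈ = proj₁ (∈-firsts⁻ x∈)

  firsts-≼ : x ∈ firsts A → z ∈ A → x ≼ z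
  firsts-≼ x∈ = proj₂ (∈-firsts⁻ x∈)

  minimum-exists : ∀ A → Nonempty A → ∃ (IsMinimum _≼_ (_∈ A))
  minimum-exists = size-induction (λ A → Nonempty A → ∃ (First A)) step
    where
    step : ∀ A → (∀ {B} → ∣ B ∣ ℕ.< ∣ A ∣ → Nonempty B → ∃ (First B)) →
           Nonempty A → ∃ (First A)
    step A rec (x , x∈A) with nonempty? (A ─ ⁅ x ⁆)
    ... | no empty = x , x∈A , λ {z} z∈A → case z Fin.≟ x of λ where
      (yes refl) → O.refl
      (no z≢x) → contradiction (z , x∈p∧x∉q⇒x∈p─q z∈A (z≢x ∘ x∈⁅y⁆⇒x≡y x)) empty
    ... | yes ne with y , y∈ , y≼ ← rec (x∈p⇒∣p-x∣<∣p∣ x∈A) ne with O.total x y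
    ...   | inj₁ x≼y = x , x∈A , λ {z} z∈A → case z Fin.≟ x of λ where
      (yes refl) → O.refl
      (no z≢x) → O.trans x≼y (y≼ (x∈p∧x∉q⇒x∈p─q z∈A (z≢x ∘ x∈⁅y⁆⇒x≡y x)))
    ...   | inj₂ y≼x = y , ─⊆ y∈ , λ {z} z∈A → case z Fin.≟ x of λ where
      (yes refl) → y≼x
      (no z≢x) → y≼ (x∈p∧x∉q⇒x∈p─q z∈A (z≢x ∘ x∈⁅y⁆⇒x≡y x))

  firsts-singleton : Nonempty A → ∃[ x ] firsts A ≡ ⁅ x ⁆
  firsts-singleton {A = A} ne with x , x∈ , x≼ ← minimum-exists A ne =
    x , ⊆-antisym
      (λ {z} z∈ → subst (_∈ ⁅ x ⁆) (O.antisym (x≼ (firsts-⊆ z∈)) (firsts-≼ z∈ x∈)) (x∈⁅x⁆ x))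
      (singleton⊆ (∈-firsts⁺ (x∈ , x≼)))

  -- Carries consistency from a choice to its `best`: a least element of A stays least in every part
  -- of A that contains it.
  firsts-∩ : Nonempty (firsts A ∩ L) → firsts (A ∩ L) ≡ firsts A ∩ L
  firsts-∩ (x , x∈) = let x∈A , x∈L = ∩⁻ x∈ in ⊆-antisym
    (λ z∈ → let z∈A , z∈L = ∩⁻ (firsts-⊆ z∈) in x∈p∩q⁺
      ( ∈-firsts⁺ (z∈A , λ w∈ → O.trans (firsts-≼ z∈ (x∈p∩q⁺ (firsts-⊆ x∈A , x∈L))) (firsts-≼ x∈A w∈))
      , z∈L))
    (λ z∈ → let z∈A , z∈L = ∩⁻ z∈ in
      ∈-firsts⁺ (x∈p∩q⁺ (firsts-⊆ z∈A , z∈L) , λ w∈ → firsts-≼ z∈A (proj₁ (∩⁻ w∈))))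

  -- A fixed u in U strictly precedes each v in V, so no least element of the union comes from V.
  -- The set V may be empty, as can happen to V ∩ K in `bestIn-≡`.
  firsts-∪ : Nonempty U → (∀ {u v} → u ∈ U → v ∈ V → u ≼ v × u ≢ v) → firsts U ≡ firsts (U ∪ V)
  firsts-∪ {U = U} {V} (u , u∈U) U≪V = ⊆-antisym
    (λ {z} z∈ → ∈-firsts⁺ (x∈p∪q⁺ (inj₁ (firsts-⊆ z∈)) , λ w∈ → case x∈p∪q⁻ U V w∈ of λ where
      (inj₁ w∈U) → firsts-≼ z∈ w∈U
      (inj₂ w∈V) → proj₁ (U≪V (firsts-⊆ z∈) w∈V)))
    (λ {z} z∈ → case x∈p∪q⁻ U V (firsts-⊆ z∈) of λ where
      (inj₁ z∈U) → ∈-firsts⁺ (z∈U , λ w∈ → firsts-≼ z∈ (x∈p∪q⁺ (inj₁ w∈)))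
      (inj₂ z∈V) → let u≼z , u≢z = U≪V u∈U z∈V in
        ⊥-elim (u≢z (O.antisym u≼z (firsts-≼ z∈ (x∈p∪q⁺ (inj₁ u∈U))))))

-- Splittings and connected components.

module _ {n : ℕ} (H : Hypergraph n) where

  -- In the language of nestohedra, the members of the building set generated by H. Supports of
  -- subtrees are blocks, and constructs are compared through their values on blocks.
  Block : Subset n → Set
  Block K = Nonempty K × Connected H K

  -- Only one inclusion of `≐` has content: a hyperedge inside a part of X is inside X anyway.
  splits : A ⊆ X → (∀ {Z} → Edge H Z → Z ⊆ X → Z ⊆ A ⊎ Z ⊆ X ─ A) → Splits H X A
  splits {A = A} {X = X} A⊆X f = A⊆X , into , λ where
      (inj₁ (e , Z⊆A)) → e , A⊆X ∘ Z⊆A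
      (inj₂ (e , Z⊆)) → e , ─⊆ ∘ Z⊆
    where
    into : ∀ {Z} → (H ↾ X) Z → (H ↾ A) Z ⊎ (H ↾ (X ─ A)) Z
    into (e , Z⊆X) with f e Z⊆X
    ... | inj₁ Z⊆A = inj₁ (e , Z⊆A)
    ... | inj₂ Z⊆ = inj₂ (e , Z⊆)

  splits-edge : Splits H X A → Edge H Z → Z ⊆ X → Z ⊆ A ⊎ Z ⊆ X ─ A
  splits-edge (_ , f , _) e Z⊆X with f (e , Z⊆X)
  ... | inj₁ (_ , Z⊆A) = inj₁ Z⊆A
  ... | inj₂ (_ , Z⊆) = inj₂ Z⊆

  -- The three inclusions say that B is A ∩ Y, without forcing the uses to present B as an
  -- intersection.
  splits-restrict : Splits H X A → Y ⊆ X → B ⊆ Y → B ⊆ A →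
                    (∀ {x} → x ∈ A → x ∈ Y → x ∈ B) → Splits H Y B
  splits-restrict {A = A} {Y = Y} {B = B} s Y⊆X B⊆Y B⊆A A∩Y⊆B = splits B⊆Y part
    where
    part : ∀ {Z} → Edge H Z → Z ⊆ Y → Z ⊆ B ⊎ Z ⊆ Y ─ B
    part e Z⊆Y with splits-edge s e (Y⊆X ∘ Z⊆Y)
    ... | inj₁ Z⊆A = inj₁ λ z∈ → A∩Y⊆B (Z⊆A z∈) (Z⊆Y z∈)
    ... | inj₂ Z⊆ = inj₂ λ z∈ → x∈p∧x∉q⇒x∈p─q (Z⊆Y z∈) (∈─⇒∉ (Z⊆ z∈) ∘ B⊆A)

  splits-refl : Splits H X X
  splits-refl = splits id λ _ → inj₁

  splits-trans : Splits H X A → Splits H A B → Splits H X B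
  splits-trans {X = X} {A} {B} s@(A⊆X , _) t@(B⊆A , _) = splits (A⊆X ∘ B⊆A) part
    where
    part : ∀ {Z} → Edge H Z → Z ⊆ X → Z ⊆ B ⊎ Z ⊆ X ─ B
    part e Z⊆X with splits-edge s e Z⊆X
    ... | inj₂ Z⊆ = inj₂ λ z∈ → x∈p∧x∉q⇒x∈p─q (─⊆ (Z⊆ z∈)) (∈─⇒∉ (Z⊆ z∈) ∘ B⊆A)
    ... | inj₁ Z⊆A with splits-edge t e Z⊆A
    ...   | inj₁ Z⊆B = inj₁ Z⊆B
    ...   | inj₂ Z⊆ = inj₂ (─-monoˡ-⊆ A⊆X ∘ Z⊆)

  splits-complement : Splits H X A → Splits H X (X ─ A)
  splits-complement {X = X} {A} s@(A⊆X , _) = splits ─⊆ part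
    where
    part : ∀ {Z} → Edge H Z → Z ⊆ X → Z ⊆ X ─ A ⊎ Z ⊆ X ─ (X ─ A)
    part e Z⊆X with splits-edge s e Z⊆X
    ... | inj₁ Z⊆A = inj₂ λ z∈ → x∈p∧x∉q⇒x∈p─q (Z⊆X z∈) λ z∈─ → ∈─⇒∉ z∈─ (Z⊆A z∈)
    ... | inj₂ Z⊆ = inj₁ Z⊆

  -- If C also had a point outside A, then C ∩ A would be a proper part splitting C.
  connected-⊆ : Connected H C → C ⊆ X → Splits H X A → x ∈ C → x ∈ A → C ⊆ A
  connected-⊆ {C = C} {A = A} conn C⊆X s x∈C x∈A {y} y∈C with y ∈? A
  ... | yes y∈A = y∈A
  ... | no y∉A = contradiction
    ( C ∩ A , (_ , x∈p∩q⁺ (x∈C , x∈A))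
    , (y , x∈p∧x∉q⇒x∈p─q y∈C (y∉A ∘ proj₂ ∘ ∩⁻))
    , splits-restrict s C⊆X (proj₁ ∘ ∩⁻) (proj₂ ∘ ∩⁻) (λ x∈A x∈C → x∈p∩q⁺ (x∈C , x∈A)))
    conn

  component-⊆ : Component H X C → C ⊆ X
  component-⊆ (_ , _ , C⊆X , _) = C⊆X

  component-block : Component H X C → Block C
  component-block (ne , conn , _) = ne , conn

  component-unique : Component H X C → Component H X D → x ∈ C → x ∈ D → C ≡ D
  component-unique (_ , c , s@(C⊆X , _)) (_ , d , t@(D⊆X , _)) x∈C x∈D =
    ⊆-antisym (connected-⊆ c C⊆X t x∈C x∈D) (connected-⊆ d D⊆X s x∈D x∈C)

  -- As long as the set is not connected, it is split and the part containing x is kept; each split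
  -- makes it strictly smaller.
  component-at : x ∈ X → ∃[ C ] Component H X C × x ∈ C
  component-at {x = x} {X = X} = size-induction
    (λ X → x ∈ X → ∃[ C ] Component H X C × x ∈ C) step X
    where
    step : ∀ X → (∀ {Y} → ∣ Y ∣ ℕ.< ∣ X ∣ → x ∈ Y → ∃[ C ] Component H Y C × x ∈ C) →
           x ∈ X → ∃[ C ] Component H X C × x ∈ C
    step X rec x∈X with anySubset? (λ A →
      nonempty? A ×-dec nonempty? (X ─ A) ×-dec splits? H X A)
    ... | no conn = X , ((x , x∈X) , conn , splits-refl) , x∈X
    ... | yes (A , neA , (z , z∈) , s@(A⊆X , _)) with x ∈? A
    ...   | yes x∈A =
      let C , (ne , c , t) , x∈C = rec (p⊂q⇒∣p∣<∣q∣ (A⊆X , z , ─⊆ z∈ , ∈─⇒∉ z∈)) x∈A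
      in  C , (ne , c , splits-trans s t) , x∈C
    ...   | no x∉A =
      let C , (ne , c , t) , x∈C = rec (∣─∣< A⊆X neA) (x∈p∧x∉q⇒x∈p─q x∈X x∉A)
      in  C , (ne , c , splits-trans (splits-complement s) t) , x∈C

  block-within : Block K → K ⊆ X → ∃[ C ] Component H X C × K ⊆ C
  block-within ((x , x∈K) , conn) K⊆X =
    let C , (ne , c , s) , x∈C = component-at (K⊆X x∈K)
    in  C , (ne , c , s) , connected-⊆ conn K⊆X s x∈K x∈C

  components-unique : ∀ X → Unique (components H X)
  components-unique X = Unique.filter⁺ (component? H X) (subsets-unique n)

  ∈-components⁺ : Component H X C → C List.∈ components H X
  ∈-components⁺ {X = X} c = ∈-filter⁺ (component? H X) (∈-subsets _) c

  ∈-components⁻ : C List.∈ components H X → Component H X C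
  ∈-components⁻ {X = X} C∈ = proj₂ (∈-filter⁻ (component? H X) {xs = subsets n} C∈)

  -- Deleting a part B of one component K leaves the other components intact and breaks up K alone.
  -- With its converse this matches `Remains` with the components left after both nodes of an edge
  -- are deleted.
  component-─⁺ : Component H X K → Component H X L × L ≢ K ⊎ Component H (K ─ B) L →
                 B ⊆ K → Component H (X ─ B) L
  component-─⁺ k@(_ , _ , K⊆X , _) (inj₁ (l@(ne , c , s@(L⊆X , _)) , L≢K)) B⊆K =
    ne , c , splits-restrict s ─⊆
      (λ x∈L → x∈p∧x∉q⇒x∈p─q (L⊆X x∈L) λ x∈B → L≢K (component-unique l k x∈L (B⊆K x∈B)))
      id (λ x∈L _ → x∈L)
  component-─⁺ (_ , _ , s@(K⊆X , _)) (inj₂ (ne , c , t)) B⊆K =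
    ne , c , splits-trans
      (splits-restrict s ─⊆ (─-monoˡ-⊆ K⊆X) ─⊆ (λ x∈K x∈ → x∈p∧x∉q⇒x∈p─q x∈K (∈─⇒∉ x∈))) t

  component-─⁻ : Component H X K → B ⊆ K → Component H (X ─ B) L →
                 Component H X L × L ≢ K ⊎ Component H (K ─ B) L
  component-─⁻ {X = X} {K} {B} {L} k B⊆K (ne@(x , x∈L) , c , t@(L⊆ , _))
    with D , d , L⊆D ← block-within (ne , c) (─⊆ ∘ L⊆) with x ∈? K
  ... | yes x∈K = inj₂ (ne , c , splits-restrict t (─-monoˡ-⊆ (component-⊆ k)) L⊆K─B id (λ x∈ _ → x∈))
    where
    L⊆K─B : L ⊆ K ─ B
    L⊆K─B z∈ = x∈p∧x∉q⇒x∈p─q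
      (subst (_ ∈_) (component-unique d k (L⊆D x∈L) x∈K) (L⊆D z∈)) (∈─⇒∉ (L⊆ z∈))
  ... | no x∉K = inj₁ (subst (Component H X) D≡L d , λ { refl → x∉K x∈L })
    where
    -- If D met B it would be K itself, but x lies in D and not in K.
    D⊆X─B : D ⊆ X ─ B
    D⊆X─B z∈D = x∈p∧x∉q⇒x∈p─q (component-⊆ d z∈D) λ z∈B →
      x∉K (subst (x ∈_) (component-unique d k z∈D (B⊆K z∈B)) (L⊆D x∈L))

    D≡L : D ≡ L
    D≡L = ⊆-antisym
      (connected-⊆ (proj₁ (proj₂ d)) D⊆X─B t (L⊆D x∈L) x∈L) L⊆D

  -- Immediate subtrees and induction on constructs.

  label-nonempty : (S : Construct H X) → Nonempty (label S)
  label-nonempty (node Y ne _ _) = recompute (nonempty? Y) ne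

  label-⊆ : (S : Construct H X) → label S ⊆ X
  label-⊆ {X = X} (node Y _ Y⊆X _) = recompute (Y ⊆? X) Y⊆X

  ◁-component : {t : Construct H D} {S : Construct H X} → t ◁ S → Component H (X ─ label S) D
  ◁-component {S = node _ _ _ _} (D∈ , _) = ∈-components⁻ D∈

  ◁-exists : (S : Construct H X) → Component H (X ─ label S) D → ∃[ t ] _◁_ {D = D} t S
  ◁-exists (node _ _ _ ts) d = All.lookup ts (∈-components⁺ d) , ∈-components⁺ d , refl

  -- The list of components has no repetitions, so a support has a single position in it.
  ◁-unique : {s t : Construct H D} {S : Construct H X} → s ◁ S → t ◁ S → s ≡ t
  ◁-unique {S = node Y _ _ ts} (D∈ , refl) (D∈′ , refl) =
    cong (All.lookup ts) (unique⇒irrelevant (components-unique _) D∈ D∈′)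

  ◁-⊆ : {t : Construct H D} {S : Construct H X} → t ◁ S → D ⊆ X
  ◁-⊆ t◁ = ─⊆ ∘ component-⊆ (◁-component t◁)

  ◁-disjoint : {t : Construct H D} {S : Construct H X} → t ◁ S → x ∈ D → x ∉ label S
  ◁-disjoint t◁ x∈D = ∈─⇒∉ (component-⊆ (◁-component t◁) x∈D)

  module _ {p} (P : ∀ {X} → Construct H X → Set p)
           (step : ∀ {X} (S : Construct H X) →
                   (∀ {D} {t : Construct H D} → t ◁ S → P t) → P S) where

    -- A subtree obtained by `All.lookup` is not visibly smaller, so the family of subtrees is
    -- traversed by a second, mutual recursion.
    construct-induction : (S : Construct H X) → P S
    construct-inductions : ∀ {Ds} (ts : All (Construct H) Ds) {D} (D∈ : D List.∈ Ds) →
                           P (All.lookup ts D∈)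
    construct-induction (node Y ne Y⊆X ts) =
      step (node Y ne Y⊆X ts) λ where (D∈ , refl) → construct-inductions ts D∈
    construct-inductions (t ∷ ts) (here refl) = construct-induction t
    construct-inductions (t ∷ ts) (there D∈) = construct-inductions ts D∈

  lookup-injective : ∀ {Ds} {ts us : All (Construct H) Ds} →
                     (∀ {D} (D∈ : D List.∈ Ds) → All.lookup ts D∈ ≡ All.lookup us D∈) → ts ≡ us
  lookup-injective {ts = []} {[]} _ = refl
  lookup-injective {ts = t ∷ ts} {u ∷ us} eq =
    cong₂ _∷_ (eq (here refl)) (lookup-injective (eq ∘ there))

  lookup-tabulate : ∀ {Ds} (f : ∀ {D} → D List.∈ Ds → Construct H D) {D} (D∈ : D List.∈ Ds) →
                    All.lookup (All.tabulate f) D∈ ≡ f D∈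
  lookup-tabulate f (here refl) = refl
  lookup-tabulate f (there D∈) = lookup-tabulate (f ∘ there) D∈

  -- One inclusion suffices: equal labels leave the same components, and each component carries
  -- exactly one subtree.
  construct-≡ : {S T : Construct H X} → label S ≡ label T →
                (∀ {D} {t : Construct H D} → t ◁ S → t ◁ T) → S ≡ T
  construct-≡ {S = node Y _ _ ts} {node .Y ne Y⊆X us} refl f =
    cong (node Y _ _) (lookup-injective λ D∈ → ◁-unique {S = node Y ne Y⊆X us} (f (D∈ , refl)) (D∈ , refl))

  -- Roots of restrictions.

  -- `top S K` is the label of the root of the restriction of S to K, i.e. the
  -- part of K lying in the lowest node of S below which all of K is found.
  top : Construct H X → Subset n → Subset n
  tops : ∀ {Ds} → All (Construct H) Ds → Subset n → Subset n
  top (node Y _ _ ts) K with nonempty? (Y ∩ K)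
  ... | yes _ = Y ∩ K
  ... | no _ = tops ts K
  -- Never reached for a block inside X. The default K keeps `top` inside K and non-empty for all K,
  -- which makes `topChoice` a `Choice`.
  tops [] K = K
  tops (_∷_ {x = D} t ts) K with K ⊆? D
  ... | yes _ = top t K
  ... | no _ = tops ts K

  top-⊆ : (S : Construct H X) → top S K ⊆ K
  tops-⊆ : ∀ {Ds} (ts : All (Construct H) Ds) → tops ts K ⊆ K
  top-⊆ {K = K} (node Y _ _ ts) with nonempty? (Y ∩ K)
  ... | yes _ = proj₂ ∘ ∩⁻
  ... | no _ = tops-⊆ ts
  tops-⊆ [] = id
  tops-⊆ {K = K} (_∷_ {x = D} t ts) with K ⊆? D
  ... | yes _ = top-⊆ t
  ... | no _ = tops-⊆ ts

  top-nonempty : (S : Construct H X) → Nonempty K → Nonempty (top S K)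
  tops-nonempty : ∀ {Ds} (ts : All (Construct H) Ds) → Nonempty K → Nonempty (tops ts K)
  top-nonempty {K = K} (node Y _ _ ts) ne with nonempty? (Y ∩ K)
  ... | yes ne′ = ne′
  ... | no _ = tops-nonempty ts ne
  tops-nonempty [] ne = ne
  tops-nonempty {K = K} (_∷_ {x = D} t ts) ne with K ⊆? D
  ... | yes _ = top-nonempty t ne
  ... | no _ = tops-nonempty ts ne

  top-meets : (S : Construct H X) → Nonempty (label S ∩ K) → top S K ≡ label S ∩ K
  top-meets {K = K} (node Y _ _ ts) ne with nonempty? (Y ∩ K)
  ... | yes _ = refl
  ... | no ¬ne = contradiction ne ¬ne

  top-root : (S : Construct H X) → top S X ≡ label S
  top-root S = trans
    (top-meets S (let y , y∈ = label-nonempty S in y , x∈p∩q⁺ (y∈ , label-⊆ S y∈)))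
    (⊆-antisym (proj₁ ∘ ∩⁻) λ y∈ → x∈p∩q⁺ (y∈ , label-⊆ S y∈))

  tops-lookup : ∀ {Ds} (ts : All (Construct H) Ds) (D∈ : D List.∈ Ds) → Unique Ds → K ⊆ D →
                (∀ {E} → E List.∈ Ds → K ⊆ E → E ≡ D) → tops ts K ≡ top (All.lookup ts D∈) K
  tops-lookup {K = K} (_∷_ {x = E} t ts) D∈ u K⊆D only with K ⊆? E
  tops-lookup (t ∷ ts) (here refl) u K⊆D only | yes _ = refl
  tops-lookup (t ∷ ts) (there D∈) (E∉ ∷ u) K⊆D only | yes K⊆E =
    contradiction (only (here refl) K⊆E) (All.lookup E∉ D∈)
  tops-lookup (t ∷ ts) (here refl) u K⊆D only | no K⊈E = contradiction (λ {_} → K⊆D) K⊈E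
  tops-lookup (t ∷ ts) (there D∈) (_ ∷ u) K⊆D only | no _ =
    tops-lookup ts D∈ u K⊆D (only ∘ there)

  top-below : {t : Construct H D} {S : Construct H X} → t ◁ S → K ⊆ D → Nonempty K →
              top S K ≡ top t K
  top-below {K = K} {S = node Y a b ts} t◁@(D∈ , refl) K⊆D (x , x∈K) with nonempty? (Y ∩ K)
  ... | yes (z , z∈) =
    contradiction (proj₁ (∩⁻ z∈)) (◁-disjoint {S = node Y a b ts} t◁ (K⊆D (proj₂ (∩⁻ z∈))))
  ... | no _ = tops-lookup ts D∈ (components-unique _) K⊆D
    λ E∈ K⊆E → component-unique (∈-components⁻ E∈) (∈-components⁻ D∈) (K⊆E x∈K) (K⊆D x∈K)

  -- A connected set that misses the root cannot straddle two components. Computations of `top` on a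
  -- block rest on this dichotomy.
  descend : (S : Construct H X) → Block K → K ⊆ X →
            Nonempty (label S ∩ K) ⊎ ∃₂ λ D t → _◁_ {D = D} t S × K ⊆ D
  descend {X = X} {K = K} S k K⊆X with nonempty? (label S ∩ K)
  ... | yes ne = inj₁ ne
  ... | no ¬ne =
    let D , d , K⊆D = block-within k λ x∈K →
          x∈p∧x∉q⇒x∈p─q (K⊆X x∈K) λ x∈Y → ¬ne (_ , x∈p∩q⁺ (x∈Y , x∈K))
        t , t◁ = ◁-exists S d
    in  inj₂ (D , t , t◁ , K⊆D)

  -- Restricting to K and then to L must give the same as restricting to L directly. Among choices
  -- this characterises the maps `top S` on blocks: see `top-consistent` and `top-⟦⟧`.
  Consistent : (Subset n → Subset n) → Subset n → Set
  Consistent τ X = ∀ {K L} → Block K → Block L → K ⊆ X → L ⊆ K →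
                   Nonempty (τ K ∩ L) → τ L ≡ τ K ∩ L

  consistent-⊆ : ∀ {τ} → Consistent τ X → Y ⊆ X → Consistent τ Y
  consistent-⊆ con Y⊆X k l K⊆Y = con k l (Y⊆X ∘ K⊆Y)

  top-consistent : (S : Construct H X) → Consistent (top S) X
  top-consistent = construct-induction (λ {X} S → Consistent (top S) X) step
    where
    step : ∀ {X} (S : Construct H X) →
           (∀ {D} {t : Construct H D} → t ◁ S → Consistent (top t) D) → Consistent (top S) X
    step S rec {K} {L} k l K⊆X L⊆K ne with descend S k K⊆X
    ... | inj₁ meets rewrite top-meets S meets = trans (top-meets S ne′) (sym drop)
      where
      ne′ : Nonempty (label S ∩ L)
      ne′ = let z , z∈ = ne ; z∈₁ , z∈L = ∩⁻ z∈ in z , x∈p∩q⁺ (proj₁ (∩⁻ z∈₁) , z∈L)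
      drop : (label S ∩ K) ∩ L ≡ label S ∩ L
      drop = ⊆-antisym
        (λ z∈ → let z∈₁ , z∈L = ∩⁻ z∈ in x∈p∩q⁺ (proj₁ (∩⁻ z∈₁) , z∈L))
        (λ z∈ → let z∈Y , z∈L = ∩⁻ z∈ in x∈p∩q⁺ (x∈p∩q⁺ (z∈Y , L⊆K z∈L) , z∈L))
    ... | inj₂ (D , t , t◁ , K⊆D)
      rewrite top-below t◁ K⊆D (proj₁ k) | top-below t◁ (K⊆D ∘ L⊆K) (proj₁ l) =
      rec t◁ k l K⊆D L⊆K ne

  -- Constructs generated by choice functions.

  record Choice : Set where
    field
      pick          : Subset n → Subset n
      pick-⊆        : pick K ⊆ K
      pick-nonempty : Nonempty K → Nonempty (pick K)

  open Choice

  topChoice : Construct H X → Choice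
  topChoice S = record { pick = top S ; pick-⊆ = top-⊆ S ; pick-nonempty = top-nonempty S }

  smaller : A ⊆ X → Nonempty A → Component H (X ─ A) K → ∣ K ∣ ℕ.< ∣ X ∣
  smaller A⊆X ne k = ℕ.≤-<-trans (p⊆q⇒∣p∣≤∣q∣ (component-⊆ k)) (∣─∣< A⊆X ne)

  nonempty-size : Nonempty X → ¬ ∣ X ∣ ℕ.≤ 0
  nonempty-size {X = X} (x , x∈X) le =
    ℕ.<⇒≱ (ℕ.≤-<-trans ℕ.z≤n (x∈p⇒∣p-x∣<∣p∣ x∈X)) le

  -- ⟦ τ ⟧ X is the construct of H_X obtained by repeatedly cutting off the
  -- part picked by τ; the natural number bounds the size of X.
  build : ∀ k (τ : Choice) X → .(Nonempty X) → .(∣ X ∣ ℕ.≤ k) → Construct H X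
  build zero τ X ne le = ⊥-elim-irr (nonempty-size ne le)
  build (suc k) τ X ne le = node (pick τ X) (pick-nonempty τ ne) (pick-⊆ τ)
    (All.tabulate λ {K} K∈ → build k τ K (proj₁ (∈-components⁻ K∈))
      (ℕ.s≤s⁻¹ (ℕ.≤-trans (smaller (pick-⊆ τ) (pick-nonempty τ ne) (∈-components⁻ K∈)) le)))

  build-irrelevant : ∀ {k l τ} .{ne : Nonempty X} .{k≥ : ∣ X ∣ ℕ.≤ k} .{l≥ : ∣ X ∣ ℕ.≤ l} →
                     build k τ X ne k≥ ≡ build l τ X ne l≥
  build-irrelevant {k = zero} {ne = ne} {k≥} = ⊥-elim-irr (nonempty-size ne k≥)
  build-irrelevant {k = suc k} {zero} {ne = ne} {l≥ = l≥} = ⊥-elim-irr (nonempty-size ne l≥)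
  build-irrelevant {k = suc k} {suc l} = cong (node _ _ _) (lookup-injective λ K∈ →
    trans (lookup-tabulate _ K∈) (trans (build-irrelevant {k = k} {l}) (sym (lookup-tabulate _ K∈))))

  ⟦_⟧ : Choice → ∀ X → .{Nonempty X} → Construct H X
  ⟦ τ ⟧ X {ne} = build ∣ X ∣ τ X ne ℕ.≤-refl

  -- Frees the root from τ: the intermediate trees of `graft-⊑` and both ends of a flip have this
  -- form.
  graft : (τ : Choice) (A : Subset n) → .(Nonempty A) → .(A ⊆ X) → Construct H X
  graft τ A ne A⊆X = node A ne A⊆X
    (All.tabulate λ {K} K∈ → ⟦ τ ⟧ K {proj₁ (∈-components⁻ K∈)})

  ⟦⟧≡graft : ∀ {τ} .{ne : Nonempty X} .{a : Nonempty A} .{A⊆X : A ⊆ X} →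
             pick τ X ≡ A → ⟦ τ ⟧ X {ne} ≡ graft τ A a A⊆X
  ⟦⟧≡graft {X = X} {τ = τ} {ne} refl = trans
    (build-irrelevant {k = ∣ X ∣} {suc ∣ X ∣} {τ} {ne} {ℕ.≤-refl} {ℕ.n≤1+n _})
    (cong (node _ _ _) (lookup-injective λ {K} K∈ → trans (lookup-tabulate _ K∈)
      (trans (build-irrelevant {k = ∣ X ∣} {∣ K ∣} {l≥ = ℕ.≤-refl}) (sym (lookup-tabulate _ K∈)))))

  ⟦⟧≡graft-pick : ∀ {τ} .{ne : Nonempty X} →
                  ⟦ τ ⟧ X {ne} ≡ graft τ (pick τ X) (pick-nonempty τ ne) (pick-⊆ τ)
  ⟦⟧≡graft-pick {τ = τ} {ne} = ⟦⟧≡graft {τ = τ} {ne} refl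

  label-⟦⟧ : ∀ {τ} .{ne : Nonempty X} → label (⟦ τ ⟧ X {ne}) ≡ pick τ X
  label-⟦⟧ {τ = τ} {ne} = cong label (⟦⟧≡graft-pick {τ = τ} {ne})

  ◁-graft⁺ : ∀ {τ} .{ne : Nonempty A} .{A⊆X : A ⊆ X} (d : Component H (X ─ A) D) →
             ⟦ τ ⟧ D {proj₁ d} ◁ graft τ A ne A⊆X
  ◁-graft⁺ d = ∈-components⁺ d , lookup-tabulate _ (∈-components⁺ d)

  ◁-graft⁻ : ∀ {τ} .{ne : Nonempty A} .{A⊆X : A ⊆ X} {t : Construct H D} →
             t ◁ graft τ A ne A⊆X →
             ∃ λ (d : Component H (X ─ A) D) → t ≡ ⟦ τ ⟧ D {proj₁ d}
  ◁-graft⁻ (D∈ , refl) = ∈-components⁻ D∈ , lookup-tabulate _ D∈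

  ◁-⟦⟧⁺ : ∀ {τ} .{ne : Nonempty X} (d : Component H (X ─ pick τ X) D) →
          ⟦ τ ⟧ D {proj₁ d} ◁ ⟦ τ ⟧ X {ne}
  ◁-⟦⟧⁺ {τ = τ} {ne} d = subst (_ ◁_) (sym (⟦⟧≡graft-pick {τ = τ} {ne}))
    (◁-graft⁺ {τ = τ} {pick-nonempty τ ne} {pick-⊆ τ} d)

  ◁-⟦⟧⁻ : ∀ {τ} .{ne : Nonempty X} {t : Construct H D} → t ◁ ⟦ τ ⟧ X {ne} →
          ∃ λ (d : Component H (X ─ pick τ X) D) → t ≡ ⟦ τ ⟧ D {proj₁ d}
  ◁-⟦⟧⁻ {τ = τ} {ne} t◁ =
    ◁-graft⁻ {τ = τ} {pick-nonempty τ ne} {pick-⊆ τ} (subst (_ ◁_) (⟦⟧≡graft-pick {τ = τ} {ne}) t◁)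

  Agree : (σ τ : Choice) → Subset n → Set
  Agree σ τ X = ∀ {K} → Block K → K ⊆ X → pick σ K ≡ pick τ K

  -- Induction along the components of X ─ A, where A is a non-empty part of X.
  block-induction : (P : Subset n → Set) →
                    (∀ {X} → Block X →
                     (∀ {A K} → A ⊆ X → Nonempty A → Component H (X ─ A) K → P K) → P X) →
                    Block X → P X
  block-induction {X = X} P step = size-induction (λ X → Block X → P X)
    (λ X rec b → step b λ A⊆X ne k → rec (smaller A⊆X ne k) (component-block k)) X

  ⟦⟧-cong : ∀ {σ τ} (b : Block X) → Agree σ τ X → ⟦ σ ⟧ X {proj₁ b} ≡ ⟦ τ ⟧ X {proj₁ b}
  ⟦⟧-cong {σ = σ} {τ} b = block-induction
    (λ X → .{ne : Nonempty X} → Agree σ τ X → ⟦ σ ⟧ X {ne} ≡ ⟦ τ ⟧ X {ne}) step b {proj₁ b}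
    where
    step : ∀ {X} → Block X →
      (∀ {A K} → A ⊆ X → Nonempty A → Component H (X ─ A) K →
        .{ne : Nonempty K} → Agree σ τ K → ⟦ σ ⟧ K {ne} ≡ ⟦ τ ⟧ K {ne}) →
      .{ne : Nonempty X} → Agree σ τ X → ⟦ σ ⟧ X {ne} ≡ ⟦ τ ⟧ X {ne}
    step {X} b rec {ne} agree = construct-≡
      (trans (label-⟦⟧ {τ = σ} {ne}) (trans (agree b id) (sym (label-⟦⟧ {τ = τ} {ne}))))
      λ t◁ → case ◁-⟦⟧⁻ {τ = σ} {ne} t◁ of λ where
        (d , refl) → subst (_◁ ⟦ τ ⟧ X {ne})
          (sym (rec (pick-⊆ σ) (pick-nonempty σ (proj₁ b)) d
            (λ k K⊆D → agree k (─⊆ ∘ component-⊆ d ∘ K⊆D))))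
          (◁-⟦⟧⁺ {τ = τ} {ne} (subst (λ A → Component H (X ─ A) _) (agree b id) d))

  -- Every construct thus comes from a choice. The induction closes because `top S` and `top t`
  -- agree on the blocks inside the support of an immediate subtree t.
  ⟦top⟧ : (S : Construct H X) .{ne : Nonempty X} → Block X → ⟦ topChoice S ⟧ X {ne} ≡ S
  ⟦top⟧ = construct-induction
    (λ {X} S → .{ne : Nonempty X} → Block X → ⟦ topChoice S ⟧ X {ne} ≡ S) step
    where
    step : ∀ {X} (S : Construct H X) →
      (∀ {D} {t : Construct H D} → t ◁ S →
        .{ne : Nonempty D} → Block D → ⟦ topChoice t ⟧ D {ne} ≡ t) →
      .{ne : Nonempty X} → Block X → ⟦ topChoice S ⟧ X {ne} ≡ S
    step {X} S rec {ne} b = construct-≡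
      (trans (label-⟦⟧ {τ = topChoice S} {ne}) (top-root S))
      λ t◁ → case ◁-⟦⟧⁻ {τ = topChoice S} {ne} t◁ of λ where
        (d , refl) →
          let d′ = subst (λ A → Component H (X ─ A) _) (top-root S) d
              t , t◁S = ◁-exists S d′
          in  subst (_◁ S)
                (sym (trans
                  (⟦⟧-cong (component-block d)
                    (λ k K⊆D → top-below t◁S K⊆D (proj₁ k)))
                  (rec t◁S (component-block d))))
                t◁S

  -- If the root meets K, consistency between X and K identifies the intersection with `pick τ K`;
  -- otherwise K lies in a subtree generated by the same τ.
  top-⟦⟧ : ∀ {τ} (b : Block X) → Consistent (pick τ) X →
           Block K → K ⊆ X → top (⟦ τ ⟧ X {proj₁ b}) K ≡ pick τ K
  top-⟦⟧ {K = K} {τ} b = block-induction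
    (λ X → .{ne : Nonempty X} → Consistent (pick τ) X → Block K → K ⊆ X →
           top (⟦ τ ⟧ X {ne}) K ≡ pick τ K) step b {proj₁ b}
    where
    step : ∀ {X} → Block X →
      (∀ {A D} → A ⊆ X → Nonempty A → Component H (X ─ A) D →
        .{ne : Nonempty D} → Consistent (pick τ) D → Block K → K ⊆ D →
        top (⟦ τ ⟧ D {ne}) K ≡ pick τ K) →
      .{ne : Nonempty X} → Consistent (pick τ) X → Block K → K ⊆ X →
      top (⟦ τ ⟧ X {ne}) K ≡ pick τ K
    step {X} b rec {ne} con k K⊆X with descend (⟦ τ ⟧ X {ne}) k K⊆X
    ... | inj₁ meets = trans (top-meets (⟦ τ ⟧ X {ne}) meets) (trans
      (cong (_∩ K) (label-⟦⟧ {τ = τ} {ne}))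
      (sym (con b k id K⊆X (subst (λ A → Nonempty (A ∩ K)) (label-⟦⟧ {τ = τ} {ne}) meets))))
    ... | inj₂ (D , t , t◁ , K⊆D) with d , refl ← ◁-⟦⟧⁻ {τ = τ} {ne} t◁ =
      trans (top-below t◁ K⊆D (proj₁ k))
        (rec (pick-⊆ τ) (pick-nonempty τ (proj₁ b)) d
          (consistent-⊆ con (─⊆ ∘ component-⊆ d)) k K⊆D)

  -- Sequences of steps carried out inside subtrees.

  -- The closure property supplied by the constructor `there` of `Replace`, common to contractions
  -- and flips.
  Congruent : (∀ {X} → Rel (Construct H X) 0ℓ) → Set
  Congruent _~_ = ∀ {X C} {S T : Construct H X} {P Q : Construct H C} →
    label S ≡ label T → P ◁ S → Q ◁ T →
    (∀ {D} (t : Construct H D) → D ≢ C → t ◁ S ⇔ t ◁ T) → P ~ Q → S ~ T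

  module _ {_~_ : ∀ {X} → Rel (Construct H X) 0ℓ} where

    data OneStep : ∀ {Ds} → Rel (All (Construct H) Ds) 0ℓ where
      here  : ∀ {D Ds} {t u : Construct H D} {ts : All (Construct H) Ds} →
              t ~ u → OneStep (t ∷ ts) (u ∷ ts)
      there : ∀ {D Ds} {t : Construct H D} {ts us : All (Construct H) Ds} →
              OneStep ts us → OneStep (t ∷ ts) (t ∷ us)

    -- The subtrees are treated from left to right, each undergoing its whole sequence of steps
    -- before the next.
    steps : ∀ {Ds} {ts us : All (Construct H) Ds} →
            (∀ {D} (D∈ : D List.∈ Ds) → Star _~_ (All.lookup ts D∈) (All.lookup us D∈)) →
            Star OneStep ts us
    steps {ts = []} {[]} f = ε
    steps {ts = t ∷ ts} {u ∷ us} f =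
      gmap (_∷ ts) here (f (here refl)) ◅◅ gmap (u ∷_) there (steps (f ∘ there))

    oneStep-lookup : ∀ {Ds} {ts us : All (Construct H) Ds} → OneStep ts us →
      ∃₂ λ C (C∈ : C List.∈ Ds) → All.lookup ts C∈ ~ All.lookup us C∈ ×
        (∀ {D} (D∈ : D List.∈ Ds) → D ≢ C → All.lookup ts D∈ ≡ All.lookup us D∈)
    oneStep-lookup (here {D = C} t~u) = C , here refl , t~u , λ where
      (here refl) D≢C → contradiction refl D≢C
      (there _) _ → refl
    oneStep-lookup (there s) =
      let C , C∈ , t~u , same = oneStep-lookup s in C , there C∈ , t~u , λ where
        (here refl) _ → refl
        (there D∈) → same D∈

    graft-star : Congruent _~_ → ∀ {X A σ τ} .{ne : Nonempty A} .{A⊆X : A ⊆ X} →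
      (∀ {D} (d : Component H (X ─ A) D) → Star _~_ (⟦ σ ⟧ D {proj₁ d}) (⟦ τ ⟧ D {proj₁ d})) →
      Star _~_ (graft σ A ne A⊆X) (graft τ A ne A⊆X)
    graft-star congruent {A = A} {σ} {τ} {ne} {A⊆X} f = gmap (node A ne A⊆X) lift
      (steps λ D∈ → subst₂ (Star _~_)
        (sym (lookup-tabulate _ D∈)) (sym (lookup-tabulate _ D∈)) (f (∈-components⁻ D∈)))
      where
      lift : ∀ {ts us} → OneStep ts us → node A ne A⊆X ts ~ node A ne A⊆X us
      lift s =
        let C , C∈ , t~u , same = oneStep-lookup s
        in  congruent {S = node A ne A⊆X _} {T = node A ne A⊆X _}
              refl (C∈ , refl) (C∈ , refl)
              (λ t D≢C → mk⇔ (λ (D∈ , eq) → D∈ , trans (sym (same D∈ D≢C)) eq)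
                             (λ (D∈ , eq) → D∈ , trans (same D∈ D≢C) eq))
              t~u

    ⟦⟧-star : Congruent _~_ → ∀ {X σ τ} .{ne : Nonempty X} → pick σ X ≡ pick τ X →
      (∀ {D} (d : Component H (X ─ pick σ X) D) →
        Star _~_ (⟦ σ ⟧ D {proj₁ d}) (⟦ τ ⟧ D {proj₁ d})) →
      Star _~_ (⟦ σ ⟧ X {ne}) (⟦ τ ⟧ X {ne})
    ⟦⟧-star congruent {X} {σ} {τ} {ne} eq f = subst₂ (Star _~_)
      (sym (⟦⟧≡graft-pick {τ = σ} {ne}))
      (sym (⟦⟧≡graft {τ = τ} {ne} {pick-nonempty σ ne} {pick-⊆ σ} (sym eq)))
      (graft-star congruent {ne = pick-nonempty σ ne} {pick-⊆ σ} f)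

  -- Refinement as containment of choices.

  facet-congruent : Congruent _FacetOf_
  facet-congruent eq P◁ Q◁ same (U , V , r) = U , V , there eq P◁ Q◁ same r

  remains-graft⁻ : ∀ {τ} .{ne : Nonempty A} .{A⊆X : A ⊆ X} (k : Component H (X ─ A) K)
    {t : Construct H D} → Remains (graft τ A ne A⊆X) (⟦ τ ⟧ K {proj₁ k}) t →
    ∃ λ (d : Component H (X ─ A ─ pick τ K) D) → t ≡ ⟦ τ ⟧ D {proj₁ d}
  remains-graft⁻ {τ = τ} {ne} {A⊆X} k (inj₁ (t◁ , D≢K)) =
    let d , eq = ◁-graft⁻ {τ = τ} {ne} {A⊆X} t◁
    in  component-─⁺ k (inj₁ (d , D≢K)) (pick-⊆ τ) , eq
  remains-graft⁻ {τ = τ} k (inj₂ t◁) =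
    let d , eq = ◁-⟦⟧⁻ {τ = τ} {proj₁ k} t◁
    in  component-─⁺ k (inj₂ d) (pick-⊆ τ) , eq

  remains-graft⁺ : ∀ {τ} .{ne : Nonempty A} .{A⊆X : A ⊆ X} (k : Component H (X ─ A) K)
    (d : Component H (X ─ A ─ pick τ K) D) →
    Remains (graft τ A ne A⊆X) (⟦ τ ⟧ K {proj₁ k}) (⟦ τ ⟧ D {proj₁ d})
  remains-graft⁺ {τ = τ} {ne} {A⊆X} k d = Sum.map
    (λ (d′ , D≢K) → ◁-graft⁺ {τ = τ} {ne} {A⊆X} d′ , D≢K)
    (◁-⟦⟧⁺ {τ = τ} {proj₁ k})
    (component-─⁻ k (pick-⊆ τ) d)

  -- Deleting A and then `pick τ K` is deleting their union, and over each component that is left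
  -- both trees carry the subtree generated by τ.
  graft-contraction : ∀ {τ} .{ne : Nonempty A} .{A⊆X : A ⊆ X} (k : Component H (X ─ A) K)
    .{ne′ : Nonempty (A ∪ pick τ K)} .{⊆X : A ∪ pick τ K ⊆ X} →
    RootContraction A (pick τ K) (graft τ A ne A⊆X) (graft τ (A ∪ pick τ K) ne′ ⊆X)
  graft-contraction {A = A} {X} {K} {τ} {ne} {A⊆X} k {ne′} {⊆X} = record
    { child = ⟦ τ ⟧ K {proj₁ k}
    ; child◁ = ◁-graft⁺ {τ = τ} {ne} {A⊆X} k
    ; labelS = refl
    ; labelP = label-⟦⟧ {τ = τ} {proj₁ k}
    ; labelT = refl
    ; subtrees = λ t → mk⇔ to from
    }
    where
    ─∪ : X ─ A ─ pick τ K ≡ X ─ (A ∪ pick τ K)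
    ─∪ = p─q─r≡p─q∪r X A (pick τ K)

    to : ∀ {D} {t : Construct H D} → t ◁ graft τ (A ∪ pick τ K) ne′ ⊆X →
         Remains (graft τ A ne A⊆X) (⟦ τ ⟧ K {proj₁ k}) t
    to {D} t◁ =
      let d , eq = ◁-graft⁻ {τ = τ} {ne′} {⊆X} t◁
      in  subst (Remains (graft τ A ne A⊆X) (⟦ τ ⟧ K {proj₁ k})) (sym eq)
            (remains-graft⁺ {τ = τ} {ne} {A⊆X} k (subst (λ Y → Component H Y D) (sym ─∪) d))

    from : ∀ {D} {t : Construct H D} → Remains (graft τ A ne A⊆X) (⟦ τ ⟧ K {proj₁ k}) t →
           t ◁ graft τ (A ∪ pick τ K) ne′ ⊆X
    from {D} t◁ =
      let d , eq = remains-graft⁻ {τ = τ} {ne} {A⊆X} k t◁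
      in  subst (_◁ graft τ (A ∪ pick τ K) ne′ ⊆X) (sym eq)
            (◁-graft⁺ {τ = τ} {ne′} {⊆X} (subst (λ Y → Component H Y D) ─∪ d))

  -- An element z of `pick τ X` missing from A lies in some component K of X ─ A. By consistency the
  -- child over K is labelled `pick τ X` ∩ K, so contracting its edge brings z into the root without
  -- leaving `pick τ X`; this repeats until nothing is missing.
  graft-⊑ : ∀ {τ} (b : Block X) → Consistent (pick τ) X →
            (ne : Nonempty A) (A⊆ : A ⊆ pick τ X) →
            graft τ A ne (pick-⊆ τ ∘ A⊆) ⊑ ⟦ τ ⟧ X {proj₁ b}
  graft-⊑ {X = X} {A} {τ} b con ne A⊆ = go (suc ∣ pick τ X ─ A ∣) A ℕ.≤-refl ne A⊆
    where
    go : ∀ k A → ∣ pick τ X ─ A ∣ ℕ.< k → (ne : Nonempty A) (A⊆ : A ⊆ pick τ X) →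
         graft τ A ne (pick-⊆ τ ∘ A⊆) ⊑ ⟦ τ ⟧ X {proj₁ b}
    go (suc k) A lt ne A⊆ with nonempty? (pick τ X ─ A)
    ... | no ¬ne = subst (graft τ A ne (pick-⊆ τ ∘ A⊆) ⊑_)
      (sym (⟦⟧≡graft {τ = τ} {proj₁ b} {ne} {pick-⊆ τ ∘ A⊆} (⊆-antisym ⊇A A⊆))) ε
      where
      ⊇A : pick τ X ⊆ A
      ⊇A {z} z∈ with z ∈? A
      ... | yes z∈A = z∈A
      ... | no z∉A = contradiction (z , x∈p∧x∉q⇒x∈p─q z∈ z∉A) ¬ne
    ... | yes (z , z∈) with K , c , z∈K ← component-at {X = X ─ A} (─-monoˡ-⊆ (pick-⊆ τ) z∈) =
      (A , pick τ K , here (graft-contraction {τ = τ} {ne} {pick-⊆ τ ∘ A⊆} c {ne′} {pick-⊆ τ ∘ A′⊆}))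
      ◅ go k (A ∪ pick τ K) (ℕ.≤-trans shrinks (ℕ.s≤s⁻¹ lt)) ne′ A′⊆
      where
      pickK : pick τ K ≡ pick τ X ∩ K
      pickK = con b (component-block c) id (─⊆ ∘ component-⊆ c) (z , x∈p∩q⁺ (─⊆ z∈ , z∈K))
      ne′ : Nonempty (A ∪ pick τ K)
      ne′ = let a , a∈ = ne in a , x∈p∪q⁺ (inj₁ a∈)
      A′⊆ : A ∪ pick τ K ⊆ pick τ X
      A′⊆ x∈ with x∈p∪q⁻ A (pick τ K) x∈
      ... | inj₁ x∈A = A⊆ x∈A
      ... | inj₂ x∈K = proj₁ (∩⁻ (subst (_ ∈_) pickK x∈K))
      shrinks : ∣ pick τ X ─ (A ∪ pick τ K) ∣ ℕ.< ∣ pick τ X ─ A ∣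
      shrinks = p⊂q⇒∣p∣<∣q∣ {p = pick τ X ─ (A ∪ pick τ K)} {pick τ X ─ A}
        ( (λ x∈ → x∈p∧x∉q⇒x∈p─q (─⊆ x∈) (∈─⇒∉ x∈ ∘ x∈p∪q⁺ ∘ inj₁))
        , z , z∈
        , λ z∈′ → ∈─⇒∉ z∈′ (x∈p∪q⁺ (inj₂ (subst (z ∈_) (sym pickK) (x∈p∩q⁺ (─⊆ z∈ , z∈K))))))

  Below : (σ τ : Choice) → Subset n → Set
  Below σ τ X = ∀ {K} → Block K → K ⊆ X → pick σ K ⊆ pick τ K

  -- Under the root `pick σ X` the subtrees are coarsened to those of τ, and then `graft-⊑` enlarges
  -- the root. The converse for constructs is `⊑-top`.
  ⟦⟧-⊑ : ∀ {σ τ} (b : Block X) → Consistent (pick τ) X → Below σ τ X →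
         ⟦ σ ⟧ X {proj₁ b} ⊑ ⟦ τ ⟧ X {proj₁ b}
  ⟦⟧-⊑ {σ = σ} {τ} b = block-induction
    (λ X → .{ne : Nonempty X} → Consistent (pick τ) X → Below σ τ X →
           ⟦ σ ⟧ X {ne} ⊑ ⟦ τ ⟧ X {ne}) step b {proj₁ b}
    where
    step : ∀ {X} → Block X →
      (∀ {A D} → A ⊆ X → Nonempty A → Component H (X ─ A) D →
        .{ne : Nonempty D} → Consistent (pick τ) D → Below σ τ D → ⟦ σ ⟧ D {ne} ⊑ ⟦ τ ⟧ D {ne}) →
      .{ne : Nonempty X} → Consistent (pick τ) X → Below σ τ X → ⟦ σ ⟧ X {ne} ⊑ ⟦ τ ⟧ X {ne}
    step b rec {ne} con σ≤τ =
      subst₂ _⊑_ (sym (⟦⟧≡graft-pick {τ = σ} {ne})) refl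
        (graft-star facet-congruent {ne = pick-nonempty σ ne} {pick-⊆ σ} λ d →
          rec (pick-⊆ σ) (pick-nonempty σ (proj₁ b)) d
            (consistent-⊆ con (─⊆ ∘ component-⊆ d))
            (λ k K⊆D → σ≤τ k (─⊆ ∘ component-⊆ d ∘ K⊆D)))
      ◅◅ graft-⊑ b con (pick-nonempty σ (proj₁ b)) (σ≤τ b id)

  -- Flips and the choices that realise them.

  swap-─ : Component H (X ─ A ─ B) D → Component H (X ─ B ─ A) D
  swap-─ {X = X} {A} {B} {D} = subst (λ Y → Component H Y D) (p─q─r≡p─r─q X A B)

  -- Apart from the nodes x and y, both trees consist of subtrees over the components of X without x
  -- and y, where σ and τ agree. By `component-─⁻` such a component either lies in L or is a
  -- component of X ─ ⁅ y ⁆ other than L; these cases are `inner` and `outer`.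
  graft-flip : ∀ {σ τ} .{nex : Nonempty ⁅ x ⁆} .{ney : Nonempty ⁅ y ⁆}
    .{x⊆X : ⁅ x ⁆ ⊆ X} .{y⊆X : ⁅ y ⁆ ⊆ X} →
    (k : Component H (X ─ ⁅ x ⁆) K) → pick σ K ≡ ⁅ y ⁆ →
    (l : Component H (X ─ ⁅ y ⁆) L) → pick τ L ≡ ⁅ x ⁆ →
    (∀ {D} → Block D → D ⊆ X → x ∉ D → y ∉ D → pick σ D ≡ pick τ D) →
    RootFlip x y (graft {X = X} σ ⁅ x ⁆ nex x⊆X) (graft τ ⁅ y ⁆ ney y⊆X)
  graft-flip {x = x} {y} {X} {K} {L} {σ} {τ} {nex} {ney} {x⊆X} {y⊆X} k σK l τL agree = record
    { child = child
    ; child◁ = ◁-graft⁺ {τ = σ} {nex} {x⊆X} k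
    ; labelS = refl
    ; labelP = trans (label-⟦⟧ {τ = σ} {proj₁ k}) σK
    ; child′ = child′
    ; child′◁ = ◁-graft⁺ {τ = τ} {ney} {y⊆X} l
    ; x∈ = pick-⊆ τ (subst (x ∈_) (sym τL) (x∈⁅x⁆ x))
    ; labelS′ = refl
    ; labelP′ = trans (label-⟦⟧ {τ = τ} {proj₁ l}) τL
    ; inner = λ t → mk⇔ inner-to inner-from
    ; outer = λ t → mk⇔ outer-to outer-from
    }
    where
    S : Construct H X
    S = graft σ ⁅ x ⁆ nex x⊆X
    S′ : Construct H X
    S′ = graft τ ⁅ y ⁆ ney y⊆X
    child : Construct H K
    child = ⟦ σ ⟧ K {proj₁ k}
    child′ : Construct H L
    child′ = ⟦ τ ⟧ L {proj₁ l}

    common : (d : Component H (X ─ ⁅ x ⁆ ─ ⁅ y ⁆) D) → ⟦ σ ⟧ D {proj₁ d} ≡ ⟦ τ ⟧ D {proj₁ d}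
    common d = ⟦⟧-cong (component-block d) λ b K⊆D → agree b
      (─⊆ ∘ ─⊆ ∘ component-⊆ d ∘ K⊆D)
      (λ x∈K → ∈─⇒∉ (─⊆ (component-⊆ d (K⊆D x∈K))) (x∈⁅x⁆ x))
      (λ y∈K → ∈─⇒∉ (component-⊆ d (K⊆D y∈K)) (x∈⁅x⁆ y))

    remains⁺ : {t : Construct H D} (d : Component H (X ─ ⁅ y ⁆ ─ ⁅ x ⁆) D) →
               t ≡ ⟦ τ ⟧ D {proj₁ d} → Remains S child t
    remains⁺ {D} d eq =
      subst (Remains S child) (trans (common (swap-─ d)) (sym eq))
        (remains-graft⁺ {τ = σ} {nex} {x⊆X} k
          (subst (λ B → Component H (X ─ ⁅ x ⁆ ─ B) D) (sym σK) (swap-─ d)))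

    remains⁻ : {t : Construct H D} → Remains S child t →
               ∃ λ (d : Component H (X ─ ⁅ y ⁆ ─ ⁅ x ⁆) D) → t ≡ ⟦ τ ⟧ D {proj₁ d}
    remains⁻ {D} r =
      let d , eq = remains-graft⁻ {τ = σ} {nex} {x⊆X} k r
          d′ = subst (λ B → Component H (X ─ ⁅ x ⁆ ─ B) D) σK d
      in  swap-─ d′ , trans eq (common d′)

    x⊆L : ⁅ x ⁆ ⊆ L
    x⊆L = subst (_⊆ L) τL (pick-⊆ τ)

    disjoint : Component H (X ─ ⁅ y ⁆) D → D ≢ L → ¬ D ⊆ L
    disjoint d@((_ , z∈D) , _) D≢L D⊆L = D≢L (component-unique d l z∈D (D⊆L z∈D))

    inner-to : {t : Construct H D} → t ◁ child′ → Remains S child t × D ⊆ L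
    inner-to {D} t◁ =
      let d , eq = ◁-⟦⟧⁻ {τ = τ} {proj₁ l} t◁
          d′ = subst (λ B → Component H (L ─ B) D) τL d
      in  remains⁺ (component-─⁺ l (inj₂ d′) x⊆L) eq , ─⊆ ∘ component-⊆ d′

    inner-from : {t : Construct H D} → Remains S child t × D ⊆ L → t ◁ child′
    inner-from {D} (r , D⊆L) =
      let d , eq = remains⁻ r
      in  case component-─⁻ l x⊆L d of λ where
            (inj₁ (d′ , D≢L)) → ⊥-elim (disjoint d′ D≢L D⊆L)
            (inj₂ d′) → subst (_◁ child′) (sym eq)
              (◁-⟦⟧⁺ {τ = τ} {proj₁ l} (subst (λ B → Component H (L ─ B) D) (sym τL) d′))

    outer-to : {t : Construct H D} → t ◁ S′ × D ≢ L → Remains S child t × ¬ D ⊆ L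
    outer-to (t◁ , D≢L) =
      let d , eq = ◁-graft⁻ {τ = τ} {ney} {y⊆X} t◁
      in  remains⁺ (component-─⁺ l (inj₁ (d , D≢L)) x⊆L) eq , disjoint d D≢L

    outer-from : {t : Construct H D} → Remains S child t × ¬ D ⊆ L → t ◁ S′ × D ≢ L
    outer-from (r , D⊈L) =
      let d , eq = remains⁻ r
      in  case component-─⁻ l x⊆L d of λ where
            (inj₁ (d′ , D≢L)) →
              subst (_◁ S′) (sym eq) (◁-graft⁺ {τ = τ} {ney} {y⊆X} d′) , D≢L
            (inj₂ d′) → ⊥-elim (D⊈L (─⊆ ∘ component-⊆ d′))

  -- Both directions are recorded, so that flips for the reversed order can be
  -- read backwards.
  Flip : Rel (Fin n) 0ℓ → Rel (Construct H X) 0ℓ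
  Flip _<_ S S′ = ∃₂ λ x y → y < x × Replace (RootFlip x y) S S′ × Replace (RootFlip y x) S′ S

  flip-congruent : ∀ {_<_} → Congruent (Flip _<_)
  flip-congruent eq P◁ Q◁ same (x , y , y<x , r , r′) =
    x , y , y<x , there eq P◁ Q◁ same r ,
    there (sym eq) Q◁ P◁ (λ t D≢ → mk⇔ (Equivalence.from (same t D≢)) (Equivalence.to (same t D≢))) r′

  prefer : Fin n → Choice → Choice
  prefer x τ = record
    { pick = pick′
    ; pick-⊆ = λ {K} → sub K
    ; pick-nonempty = λ {K} → non K
    }
    where
    pick′ : Subset n → Subset n
    pick′ K with x ∈? K
    ... | yes _ = ⁅ x ⁆
    ... | no _ = pick τ K
    sub : ∀ K → pick′ K ⊆ K
    sub K with x ∈? K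
    ... | yes x∈ = singleton⊆ x∈
    ... | no _ = pick-⊆ τ
    non : ∀ K → Nonempty K → Nonempty (pick′ K)
    non K with x ∈? K
    ... | yes _ = λ _ → x , x∈⁅x⁆ x
    ... | no _ = pick-nonempty τ

  prefer-∈ : ∀ {τ} → x ∈ K → pick (prefer x τ) K ≡ ⁅ x ⁆
  prefer-∈ {x = x} {K} x∈ with x ∈? K
  ... | yes _ = refl
  ... | no x∉ = contradiction x∈ x∉

  prefer-∉ : ∀ {τ} → x ∉ K → pick (prefer x τ) K ≡ pick τ K
  prefer-∉ {x = x} {K} x∉ with x ∈? K
  ... | yes x∈ = contradiction x∈ x∉
  ... | no _ = refl

  within : Subset n → Choice → Choice → Choice
  within A σ τ = record
    { pick = pick′
    ; pick-⊆ = λ {K} → sub K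
    ; pick-nonempty = λ {K} → non K
    }
    where
    pick′ : Subset n → Subset n
    pick′ K with K ⊆? A
    ... | yes _ = pick σ K
    ... | no _ = pick τ K
    sub : ∀ K → pick′ K ⊆ K
    sub K with K ⊆? A
    ... | yes _ = pick-⊆ σ
    ... | no _ = pick-⊆ τ
    non : ∀ K → Nonempty K → Nonempty (pick′ K)
    non K with K ⊆? A
    ... | yes _ = pick-nonempty σ
    ... | no _ = pick-nonempty τ

  within-⊆ : ∀ {σ τ} → K ⊆ A → pick (within A σ τ) K ≡ pick σ K
  within-⊆ {K = K} {A} K⊆A with K ⊆? A
  ... | yes _ = refl
  ... | no K⊈A = contradiction (λ {_} → K⊆A) K⊈A

  within-⊈ : ∀ {σ τ} → ¬ K ⊆ A → pick (within A σ τ) K ≡ pick τ K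
  within-⊈ {K = K} {A} K⊈A with K ⊆? A
  ... | yes K⊆A = contradiction (λ {_} → K⊆A) K⊈A
  ... | no _ = refl

  -- Reaching the extremal construction by flips.

  module _ {_≼_ : Rel (Fin n) 0ℓ} (O : IsDecTotalOrder _≡_ _≼_) where

    private
      _≪_ : Rel (Fin n) 0ℓ
      x ≪ y = x ≼ y × x ≢ y

    best : Choice → Choice
    best σ = record
      { pick = firsts O ∘ pick σ
      ; pick-⊆ = pick-⊆ σ ∘ firsts-⊆ O
      ; pick-nonempty = λ ne →
          let x , eq = firsts-singleton O (pick-nonempty σ ne)
          in  x , subst (x ∈_) (sym eq) (x∈⁅x⁆ x)
      }

    best-consistent : ∀ {σ} → Consistent (pick σ) X → Consistent (pick (best σ)) X
    best-consistent con k l K⊆X L⊆K (x , x∈) =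
      let x∈K , x∈L = ∩⁻ x∈
      in  trans (cong (firsts O) (con k l K⊆X L⊆K (x , x∈p∩q⁺ (firsts-⊆ O x∈K , x∈L))))
            (firsts-∩ O (x , x∈))

    -- The counterpart of `ConstructionIn` for choices: for consistent σ, the tree of τ is a
    -- construction refining that of σ.
    Chooses : (τ σ : Choice) → Subset n → Set
    Chooses τ σ X = ∀ {K} → Block K → K ⊆ X → ∃[ x ] pick τ K ≡ ⁅ x ⁆ × x ∈ pick σ K

    -- With root c and better root y, the component M of X ─ {c} containing y
    -- is first made to have root y; then c and y are flipped.
    flip-root : ∀ {σ τ c y} (b : Block X) → Consistent (pick σ) X → Chooses τ σ X →
      pick τ X ≡ ⁅ c ⁆ → c ∈ pick σ X → pick (best σ) X ≡ ⁅ y ⁆ → c ≢ y →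
      (∀ {K} (k : Component H (X ─ ⁅ c ⁆) K) →
        Star (Flip _≪_) (⟦ τ ⟧ K {proj₁ k}) (⟦ best σ ⟧ K {proj₁ k})) →
      ∃[ τ″ ] Chooses τ″ σ X × pick τ″ X ≡ ⁅ y ⁆ ×
        Star (Flip _≪_) (⟦ τ ⟧ X {proj₁ b}) (⟦ τ″ ⟧ X {proj₁ b})
    flip-root {X = X} {σ} {τ} {c} {y} b con ch τX c∈σX σX c≢y rec =
      τ″ , chooses , τ″X , lower ◅◅ return swap
      where
      y∈first : y ∈ firsts O (pick σ X)
      y∈first = subst (y ∈_) (sym σX) (x∈⁅x⁆ y)
      y∈σX : y ∈ pick σ X
      y∈σX = firsts-⊆ O y∈first
      y∈X : y ∈ X
      y∈X = pick-⊆ σ y∈σX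
      c∈X : c ∈ X
      c∈X = pick-⊆ σ c∈σX

      at-y : ∃[ M ] Component H (X ─ ⁅ c ⁆) M × y ∈ M
      at-y = component-at (x∈p∧x∉q⇒x∈p─q y∈X (c≢y ∘ sym ∘ x∈⁅y⁆⇒x≡y c))
      M : Subset n
      M = proj₁ at-y
      k : Component H (X ─ ⁅ c ⁆) M
      k = proj₁ (proj₂ at-y)
      y∈M : y ∈ M
      y∈M = proj₂ (proj₂ at-y)
      c∉M : c ∉ M
      c∉M c∈M = ∈─⇒∉ (component-⊆ k c∈M) (x∈⁅x⁆ c)

      at-c : ∃[ N ] Component H (X ─ ⁅ y ⁆) N × c ∈ N
      at-c = component-at (x∈p∧x∉q⇒x∈p─q c∈X (c≢y ∘ x∈⁅y⁆⇒x≡y y))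
      N : Subset n
      N = proj₁ at-c
      l : Component H (X ─ ⁅ y ⁆) N
      l = proj₁ (proj₂ at-c)
      c∈N : c ∈ N
      c∈N = proj₂ (proj₂ at-c)
      y∉N : y ∉ N
      y∉N y∈N = ∈─⇒∉ (component-⊆ l y∈N) (x∈⁅x⁆ y)

      -- Preferring c keeps it at the root of X, and once y is removed it also puts c at the root of
      -- N, as the flip demands. The two choices differ only on sets containing y, so the subtrees
      -- that the flip moves are the same in both trees.
      τ′ τ″ : Choice
      τ′ = prefer c (within M (best σ) τ)
      τ″ = prefer y τ′

      τ′X : pick τ′ X ≡ ⁅ c ⁆
      τ′X = prefer-∈ {τ = within M (best σ) τ} c∈X
      τ″X : pick τ″ X ≡ ⁅ y ⁆
      τ″X = prefer-∈ {τ = τ′} y∈X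

      τ′-inside : ∀ {D} → D ⊆ M → pick τ′ D ≡ pick (best σ) D
      τ′-inside D⊆M = trans (prefer-∉ {τ = within M (best σ) τ} (c∉M ∘ D⊆M))
        (within-⊆ {σ = best σ} {τ} D⊆M)
      τ′-outside : ∀ {D} → c ∉ D → ¬ D ⊆ M → pick τ′ D ≡ pick τ D
      τ′-outside c∉D D⊈M = trans (prefer-∉ {τ = within M (best σ) τ} c∉D)
        (within-⊈ {σ = best σ} {τ} D⊈M)

      τ′M : pick τ′ M ≡ ⁅ y ⁆
      τ′M = trans (τ′-inside id) (trans
        (best-consistent {σ = σ} con b (component-block k) id (─⊆ ∘ component-⊆ k)
          (y , x∈p∩q⁺ (y∈first , y∈M)))
        (trans (cong (_∩ M) σX)
          (⊆-antisym (proj₁ ∘ ∩⁻) λ z∈ → x∈p∩q⁺ (z∈ , singleton⊆ y∈M z∈))))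
      τ″N : pick τ″ N ≡ ⁅ c ⁆
      τ″N = trans (prefer-∉ {τ = τ′} y∉N) (prefer-∈ {τ = within M (best σ) τ} c∈N)

      agree : ∀ {D} → y ∉ D → pick τ′ D ≡ pick τ″ D
      agree y∉D = sym (prefer-∉ {τ = τ′} y∉D)

      ∈-pick : ∀ {D z} → Block D → D ⊆ X → z ∈ D → z ∈ pick σ X → z ∈ pick σ D
      ∈-pick {z = z} d D⊆X z∈D z∈σX =
        subst (z ∈_) (sym (con b d id D⊆X (z , x∈p∩q⁺ (z∈σX , z∈D)))) (x∈p∩q⁺ (z∈σX , z∈D))

      chooses : Chooses τ″ σ X
      chooses {D} d D⊆X with y ∈? D
      ... | yes y∈D = y , refl , ∈-pick d D⊆X y∈D y∈σX
      ... | no _ with c ∈? D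
      ...   | yes c∈D = c , refl , ∈-pick d D⊆X c∈D c∈σX
      ...   | no _ with D ⊆? M
      ...     | no _ = ch d D⊆X
      ...     | yes _ =
        let z , eq = firsts-singleton O (pick-nonempty σ (proj₁ d))
        in  z , eq , firsts-⊆ O (subst (z ∈_) (sym eq) (x∈⁅x⁆ z))

      lower : Star (Flip _≪_) (⟦ τ ⟧ X {proj₁ b}) (⟦ τ′ ⟧ X {proj₁ b})
      lower = ⟦⟧-star flip-congruent {ne = proj₁ b} (trans τX (sym τ′X)) λ {D} d →
        below-root D (subst (λ A → Component H (X ─ A) D) τX d)
        where
        below-root : ∀ D (d : Component H (X ─ ⁅ c ⁆) D) →
          Star (Flip _≪_) (⟦ τ ⟧ D {proj₁ d}) (⟦ τ′ ⟧ D {proj₁ d})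
        below-root D d with y ∈? D
        ... | yes y∈D = subst (Star (Flip _≪_) _)
          (⟦⟧-cong (component-block d) λ _ E⊆D →
            sym (τ′-inside (subst (_ ⊆_) (component-unique d k y∈D y∈M) E⊆D)))
          (rec d)
        ... | no y∉D = subst (Star (Flip _≪_) _)
          (⟦⟧-cong (component-block d) λ {E} ((z , z∈E) , _) E⊆D → sym (τ′-outside
            (λ c∈E → ∈─⇒∉ (component-⊆ d (E⊆D c∈E)) (x∈⁅x⁆ c))
            (λ E⊆M → y∉D (subst (y ∈_) (component-unique k d (E⊆M z∈E) (E⊆D z∈E)) y∈M))))
          ε

      swap : Flip _≪_ (⟦ τ′ ⟧ X {proj₁ b}) (⟦ τ″ ⟧ X {proj₁ b})
      swap = subst₂ (Flip _≪_)
        (sym (⟦⟧≡graft {τ = τ′} {proj₁ b} {c , x∈⁅x⁆ c} {singleton⊆ c∈X} τ′X))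
        (sym (⟦⟧≡graft {τ = τ″} {proj₁ b} {y , x∈⁅x⁆ y} {singleton⊆ y∈X} τ″X))
        ( c , y , (firsts-≼ O y∈first c∈σX , c≢y ∘ sym)
        , here (graft-flip {σ = τ′} {τ″} k τ′M l τ″N λ _ _ _ y∉D → agree y∉D)
        , here (graft-flip {σ = τ″} {τ′} l τ″N k τ′M λ _ _ y∉D _ → sym (agree y∉D)))

    -- When the root is already the best one, induction settles the subtrees; otherwise `flip-root`
    -- corrects the root first. The induction ranges over all τ because `flip-root` replaces the
    -- choice.
    flips-to-best : ∀ {σ τ} (b : Block X) → Consistent (pick σ) X → Chooses τ σ X →
      Star (Flip _≪_) (⟦ τ ⟧ X {proj₁ b}) (⟦ best σ ⟧ X {proj₁ b})
    flips-to-best {X = X} {σ} b con ch = block-induction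
      (λ X → ∀ {τ} .{ne : Nonempty X} → Consistent (pick σ) X → Chooses τ σ X →
             Star (Flip _≪_) (⟦ τ ⟧ X {ne}) (⟦ best σ ⟧ X {ne})) step b {ne = proj₁ b} con ch
      where
      step : ∀ {X} → Block X →
        (∀ {A K} → A ⊆ X → Nonempty A → Component H (X ─ A) K →
          ∀ {τ} .{ne : Nonempty K} → Consistent (pick σ) K → Chooses τ σ K →
          Star (Flip _≪_) (⟦ τ ⟧ K {ne}) (⟦ best σ ⟧ K {ne})) →
        ∀ {τ} .{ne : Nonempty X} → Consistent (pick σ) X → Chooses τ σ X →
        Star (Flip _≪_) (⟦ τ ⟧ X {ne}) (⟦ best σ ⟧ X {ne})
      step {X} b rec {τ} {ne} con ch = main (ch b id) (firsts-singleton O (pick-nonempty σ (proj₁ b)))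
        where
        descend-to : ∀ {τ y} → Chooses τ σ X → y ∈ X → ∀ {K} (k : Component H (X ─ ⁅ y ⁆) K) →
          Star (Flip _≪_) (⟦ τ ⟧ K {proj₁ k}) (⟦ best σ ⟧ K {proj₁ k})
        descend-to ch y∈X k = rec (singleton⊆ y∈X) (_ , x∈⁅x⁆ _) k
          (consistent-⊆ con (─⊆ ∘ component-⊆ k))
          (λ d D⊆K → ch d (─⊆ ∘ component-⊆ k ∘ D⊆K))

        finish : ∀ {τ y} → Chooses τ σ X → pick τ X ≡ ⁅ y ⁆ → pick (best σ) X ≡ ⁅ y ⁆ →
          Star (Flip _≪_) (⟦ τ ⟧ X {ne}) (⟦ best σ ⟧ X {ne})
        finish {τ} {y} ch τX σX = ⟦⟧-star flip-congruent {ne = ne} (trans τX (sym σX)) λ {D} d →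
          descend-to ch (pick-⊆ τ (subst (y ∈_) (sym τX) (x∈⁅x⁆ y)))
            (subst (λ A → Component H (X ─ A) D) τX d)

        main : (∃[ c ] pick τ X ≡ ⁅ c ⁆ × c ∈ pick σ X) → (∃[ y ] pick (best σ) X ≡ ⁅ y ⁆) →
          Star (Flip _≪_) (⟦ τ ⟧ X {ne}) (⟦ best σ ⟧ X {ne})
        main (c , τX , c∈) (y , σX) with c Fin.≟ y
        ... | yes refl = finish ch τX σX
        ... | no c≢y =
          let τ″ , ch″ , τ″X , s = flip-root {σ = σ} {τ} b con ch τX c∈ σX c≢y
                (descend-to ch (pick-⊆ σ c∈))
          in  s ◅◅ finish ch″ τ″X σX

  -- Constructions and their preservation under flips.

  -- A support determines its subtree, so comparing supports decides whether t is P; matching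
  -- `itself` then identifies both the indices and the trees.
  data SameOrOther {C} (P : Construct H C) : ∀ {D} → Construct H D → Set where
    itself : SameOrOther P P
    other  : ∀ {D} {t : Construct H D} → D ≢ C → SameOrOther P t

  ◁-compare : {S : Construct H X} {P : Construct H C} {t : Construct H D} →
              P ◁ S → t ◁ S → SameOrOther P t
  ◁-compare {C = C} {D} {S = S} {P} {t} P◁ t◁ = compare (D ≟ˢ C) P P◁ t t◁
    where
    compare : ∀ {C D} → Dec (D ≡ C) → (P : Construct H C) → P ◁ S →
              (t : Construct H D) → t ◁ S → SameOrOther P t
    compare (no D≢C) P P◁ t t◁ = other D≢C
    compare (yes refl) P P◁ t t◁ = subst (SameOrOther P) (◁-unique P◁ t◁) itself

  construction : {S : Construct H X} → ∃[ x ] label S ≡ ⁅ x ⁆ →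
                 (∀ {D} {t : Construct H D} → t ◁ S → IsConstruction t) → IsConstruction S
  construction (x , eq) _ (root refl) = x , eq
  construction _ f (below t◁ Z∈) = f t◁ Z∈

  construction-label : {S : Construct H X} → IsConstruction S → ∃[ x ] label S ≡ ⁅ x ⁆
  construction-label c = c (root refl)

  construction-◁ : {S : Construct H X} {t : Construct H D} →
                   IsConstruction S → t ◁ S → IsConstruction t
  construction-◁ c t◁ Z∈ = c (below t◁ Z∈)

  -- Each step of `_≤flip_` has to start at a construction, so this property must travel along
  -- sequences of flips.
  replace-construction : {S S′ : Construct H X} → Replace (RootFlip x y) S S′ →
                         IsConstruction S → IsConstruction S′
  replace-construction {x = x} {y} {S = S} {S′} (here r) c = construction (y , labelS′) subtree
    where
    open RootFlip r
    remaining : ∀ {D} {t : Construct H D} → Remains S child t → IsConstruction t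
    remaining (inj₁ (t◁ , _)) = construction-◁ c t◁
    remaining (inj₂ t◁) = construction-◁ (construction-◁ c child◁) t◁

    subtree : ∀ {D} {t : Construct H D} → t ◁ S′ → IsConstruction t
    subtree t◁ = main (◁-compare child′◁ t◁) t◁
      where
      main : ∀ {D} {t : Construct H D} → SameOrOther child′ t → t ◁ S′ → IsConstruction t
      main {t = t} (other D≢) t◁ = remaining (proj₁ (Equivalence.to (outer t) (t◁ , D≢)))
      main itself _ =
        construction (x , labelP′) λ {D} {u} u◁ → remaining (proj₁ (Equivalence.to (inner u) u◁))
  replace-construction {S′ = T} (there {C = C} {Q = Q} eq P◁ Q◁ same r) c =
    construction (let x , e = construction-label c in x , trans (sym eq) e) subtree
    where
    subtree : ∀ {D} {t : Construct H D} → t ◁ T → IsConstruction t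
    subtree t◁ = main (◁-compare Q◁ t◁) t◁
      where
      main : ∀ {D} {t : Construct H D} → SameOrOther Q t → t ◁ T → IsConstruction t
      main {t = t} (other D≢) t◁ = construction-◁ c (Equivalence.from (same t D≢) t◁)
      main itself _ = replace-construction r (construction-◁ c P◁)

  ⟦⟧-construction : ∀ {τ} (b : Block X) → (∀ {K} → Nonempty K → ∃[ x ] pick τ K ≡ ⁅ x ⁆) →
                    IsConstruction (⟦ τ ⟧ X {proj₁ b})
  ⟦⟧-construction {τ = τ} b single = block-induction
    (λ X → .{ne : Nonempty X} → IsConstruction (⟦ τ ⟧ X {ne})) step b {proj₁ b}
    where
    step : ∀ {X} → Block X →
      (∀ {A K} → A ⊆ X → Nonempty A → Component H (X ─ A) K →
        .{ne : Nonempty K} → IsConstruction (⟦ τ ⟧ K {ne})) →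
      .{ne : Nonempty X} → IsConstruction (⟦ τ ⟧ X {ne})
    step b rec {ne} = construction
      (let x , eq = single (proj₁ b) in x , trans (label-⟦⟧ {τ = τ} {ne}) eq)
      λ t◁ → case ◁-⟦⟧⁻ {τ = τ} {ne} t◁ of λ where
        (d , eq) → subst IsConstruction (sym eq) (rec (pick-⊆ τ) (pick-nonempty τ (proj₁ b)) d)

  construction-top : (S : Construct H X) → IsConstruction S → Block K → K ⊆ X →
                     ∃[ x ] top S K ≡ ⁅ x ⁆
  construction-top {K = K} = construct-induction
    (λ {X} S → IsConstruction S → Block K → K ⊆ X → ∃[ x ] top S K ≡ ⁅ x ⁆) step
    where
    step : ∀ {X} (S : Construct H X) →
      (∀ {D} {t : Construct H D} → t ◁ S →
        IsConstruction t → Block K → K ⊆ D → ∃[ x ] top t K ≡ ⁅ x ⁆) →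
      IsConstruction S → Block K → K ⊆ X → ∃[ x ] top S K ≡ ⁅ x ⁆
    step S rec c k K⊆X with descend S k K⊆X
    ... | inj₂ (D , t , t◁ , K⊆D) =
      let x , eq = rec t◁ (construction-◁ c t◁) k K⊆D
      in  x , trans (top-below t◁ K⊆D (proj₁ k)) eq
    ... | inj₁ meets@(z , z∈) =
      let x , eq = construction-label c
          z∈Y , z∈K = ∩⁻ z∈
          z≡x = x∈⁅y⁆⇒x≡y x (subst (z ∈_) eq z∈Y)
      in  x , trans (top-meets S meets) (trans (cong (_∩ K) eq)
            (singleton-∩ (subst (_∈ K) z≡x z∈K)))

  -- The effect of a contraction on the tops.

  data TopChange (U V A B K : Subset n) : Set where
    same  : A ≡ B → TopChange U V A B K
    fused : Nonempty (U ∩ K) → A ≡ U ∩ K → B ≡ (U ∪ V) ∩ K → TopChange U V A B K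

  -- The delicate case is a block inside the contracted child that meets V: it misses U, so its top
  -- V ∩ K already equals (U ∪ V) ∩ K.
  contraction-top : {S T : Construct H X} → S ⊂[ U , V ] T → Block K → K ⊆ X →
                    TopChange U V (top S K) (top T K) K
  contraction-top {U = U} {V} {K} {S = S} {T} (here r) k K⊆X = main (descend S k K⊆X)
    where
    open RootContraction r

    top-S : label S ∩ K ≡ U ∩ K
    top-S = cong (_∩ K) labelS

    top-T : Nonempty ((U ∪ V) ∩ K) → top T K ≡ (U ∪ V) ∩ K
    top-T ne = trans (top-meets T (subst (λ A → Nonempty (A ∩ K)) (sym labelT) ne))
      (cong (_∩ K) labelT)

    in-child : K ⊆ support → Nonempty (label child ∩ K) ⊎ ∃₂ (λ E u → _◁_ {D = E} u child × K ⊆ E) →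
               top S K ≡ top T K
    in-child K⊆ (inj₂ (E , u , u◁ , K⊆E)) =
      trans (top-below child◁ K⊆ (proj₁ k)) (trans (top-below u◁ K⊆E (proj₁ k))
        (sym (top-below (Equivalence.from (subtrees u) (inj₂ u◁)) K⊆E (proj₁ k))))
    in-child K⊆ (inj₁ meets) =
      trans (top-below child◁ K⊆ (proj₁ k)) (trans (top-meets child meets)
        (trans (cong (_∩ K) labelP) (trans V∩K (sym (top-T U∪V∩K)))))
      where
      U∪V∩K : Nonempty ((U ∪ V) ∩ K)
      U∪V∩K = let z , z∈ = meets ; z∈P , z∈K = ∩⁻ z∈ in
        z , x∈p∩q⁺ (x∈p∪q⁺ (inj₂ (subst (z ∈_) labelP z∈P)) , z∈K)
      V∩K : V ∩ K ≡ (U ∪ V) ∩ K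
      V∩K = ⊆-antisym
        (λ z∈ → let z∈V , z∈K = ∩⁻ z∈ in x∈p∩q⁺ (x∈p∪q⁺ (inj₂ z∈V) , z∈K))
        (λ {z} z∈ → let z∈U∪V , z∈K = ∩⁻ z∈ in case x∈p∪q⁻ U V z∈U∪V of λ where
          (inj₁ z∈U) → ⊥-elim (◁-disjoint child◁ (K⊆ z∈K) (subst (z ∈_) (sym labelS) z∈U))
          (inj₂ z∈V) → x∈p∩q⁺ (z∈V , z∈K))

    below-root : ∀ {D} {t : Construct H D} → SameOrOther child t → t ◁ S → K ⊆ D →
                 top S K ≡ top T K
    below-root itself _ K⊆ = in-child K⊆ (descend child k K⊆)
    below-root {t = t} (other D≢) t◁ K⊆ = trans (top-below t◁ K⊆ (proj₁ k))
      (sym (top-below (Equivalence.from (subtrees t) (inj₁ (t◁ , D≢))) K⊆ (proj₁ k)))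

    main : Nonempty (label S ∩ K) ⊎ ∃₂ (λ D t → _◁_ {D = D} t S × K ⊆ D) →
           TopChange U V (top S K) (top T K) K
    main (inj₂ (D , t , t◁ , K⊆D)) = same (below-root (◁-compare child◁ t◁) t◁ K⊆D)
    main (inj₁ meets) = fused U∩K (trans (top-meets S meets) top-S) (top-T U∪V∩K)
      where
      U∩K : Nonempty (U ∩ K)
      U∩K = subst Nonempty top-S meets
      U∪V∩K : Nonempty ((U ∪ V) ∩ K)
      U∪V∩K = let z , z∈ = U∩K ; z∈U , z∈K = ∩⁻ z∈ in z , x∈p∩q⁺ (x∈p∪q⁺ (inj₁ z∈U) , z∈K)
  contraction-top {U = U} {V} {K} {S = S} {T} (there {C = C} {P = P} {Q} eq P◁ Q◁ others r) k K⊆X =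
    main (descend S k K⊆X)
    where
    below-root : ∀ {D} {t : Construct H D} → SameOrOther P t → t ◁ S → K ⊆ D →
                 TopChange U V (top S K) (top T K) K
    below-root itself _ K⊆ = subst₂ (λ A B → TopChange U V A B K)
      (sym (top-below P◁ K⊆ (proj₁ k))) (sym (top-below Q◁ K⊆ (proj₁ k)))
      (contraction-top r k K⊆)
    below-root {t = t} (other D≢) t◁ K⊆ = same (trans (top-below t◁ K⊆ (proj₁ k))
      (sym (top-below (Equivalence.to (others t D≢) t◁) K⊆ (proj₁ k))))

    main : Nonempty (label S ∩ K) ⊎ ∃₂ (λ D t → _◁_ {D = D} t S × K ⊆ D) →
           TopChange U V (top S K) (top T K) K
    main (inj₁ meets) = same (trans (top-meets S meets) (trans (cong (_∩ K) eq)
      (sym (top-meets T (subst (λ A → Nonempty (A ∩ K)) eq meets)))))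
    main (inj₂ (D , t , t◁ , K⊆D)) = below-root (◁-compare P◁ t◁) t◁ K⊆D

  -- K is the support of the subtree of S rooted at the contracted node U. There the fusion is
  -- visible in full, which `bestIn-≢` uses to tell two extremal constructions apart.
  contraction-fused : {S T : Construct H X} → S ⊂[ U , V ] T → Block X →
    ∃[ K ] Block K × K ⊆ X × top S K ≡ U × top T K ≡ U ∪ V × Nonempty U × Nonempty V
  contraction-fused {X = X} {S = S} {T} (here r) b =
    X , b , id , trans (top-root S) labelS , trans (top-root T) labelT
      , subst Nonempty labelS (label-nonempty S) , subst Nonempty labelP (label-nonempty child)
    where open RootContraction r
  contraction-fused (there eq P◁ Q◁ _ r) b =
    let K , k , K⊆ , topP , topQ , ne = contraction-fused r (component-block (◁-component P◁))
    in  K , k , ◁-⊆ P◁ ∘ K⊆ , trans (top-below P◁ K⊆ (proj₁ k)) topP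
          , trans (top-below Q◁ K⊆ (proj₁ k)) topQ , ne

  ⊑-top : {S T : Construct H X} → S ⊑ T → Block K → K ⊆ X → top S K ⊆ top T K
  ⊑-top ε k K⊆X = id
  ⊑-top {K = K} {S = S} ((U , V , r) ◅ s) k K⊆X = ⊑-top s k K⊆X ∘ grow (contraction-top r k K⊆X)
    where
    grow : ∀ {A B} → TopChange U V A B K → A ⊆ B
    grow (same refl) = id
    grow (fused _ refl refl) x∈ = let x∈U , x∈K = ∩⁻ x∈ in x∈p∩q⁺ (x∈p∪q⁺ (inj₁ x∈U) , x∈K)

  -- The extremal construction of a construct, and how contractions affect it.

  module _ {_≼_ : Rel (Fin n) 0ℓ} (O : IsDecTotalOrder _≡_ _≼_) where

    private
      module O = IsDecTotalOrder O
      _≪_ : Rel (Fin n) 0ℓ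
      x ≪ y = x ≼ y × x ≢ y

    bestIn : Block X → Construct H X → Construct H X
    bestIn {X = X} b S = ⟦ best O (topChoice S) ⟧ X {proj₁ b}

    bestIn-constructionIn : (b : Block X) (S : Construct H X) → ConstructionIn S (bestIn b S)
    bestIn-constructionIn b S =
      ⟦⟧-construction b (λ ne → firsts-singleton O (top-nonempty S ne)) ,
      subst (bestIn b S ⊑_) (⟦top⟧ S {proj₁ b} b)
        (⟦⟧-⊑ {σ = best O (topChoice S)} b (top-consistent S) λ _ _ → firsts-⊆ O)

    flips-to-bestIn : (b : Block X) {S T : Construct H X} → ConstructionIn S T →
                      Star (Flip _≪_) T (bestIn b S)
    flips-to-bestIn b {S} {T} (c , T⊑S) = subst (λ T → Star (Flip _≪_) T (bestIn b S))
      (⟦top⟧ T {proj₁ b} b)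
      (flips-to-best O {σ = topChoice S} {topChoice T} b (top-consistent S) λ k K⊆X →
        let x , eq = construction-top T c k K⊆X
        in  x , eq , ⊑-top T⊑S k K⊆X (subst (x ∈_) (sym eq) (x∈⁅x⁆ x)))

    bestIn-≡ : (b : Block X) {S T : Construct H X} → S ⊂[ U , V ] T →
               (∀ {u v} → u ∈ U → v ∈ V → u ≪ v) → bestIn b S ≡ bestIn b T
    bestIn-≡ {U = U} {V} b S⊂T U≪V = ⟦⟧-cong b λ {K} k K⊆X → agree K (contraction-top S⊂T k K⊆X)
      where
      agree : ∀ {A B} K → TopChange U V A B K → firsts O A ≡ firsts O B
      agree K (same eq) = cong (firsts O) eq
      agree K (fused ne refl refl) = trans
        (firsts-∪ O {V = V ∩ K} ne λ u∈ v∈ → U≪V (proj₁ (∩⁻ u∈)) (proj₁ (∩⁻ v∈)))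
        (cong (firsts O) (sym (∩-distribʳ-∪ K U V)))

    -- If the two trees were equal, their tops on the K of `contraction-fused` would make a least
    -- element of U least in U ∪ V, although every element of V strictly precedes it.
    bestIn-≢ : (b : Block X) {S T : Construct H X} → S ⊂[ U , V ] T →
               (∀ {u v} → u ∈ U → v ∈ V → v ≪ u) → bestIn b S ≢ bestIn b T
    bestIn-≢ {U = U} {V} b {S} {T} S⊂T V≪U eq =
      let K , k , K⊆X , topS , topT , neU , (v , v∈V) = contraction-fused S⊂T b
          x , x∈ = minimum-exists O U neU
          firsts-≡ : firsts O U ≡ firsts O (U ∪ V)
          firsts-≡ = begin
            firsts O U          ≡⟨ cong (firsts O) topS ⟨
            firsts O (top S K)  ≡⟨ top-bestIn S k K⊆X ⟨
            top (bestIn b S) K  ≡⟨ cong (λ S → top S K) eq ⟩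
            top (bestIn b T) K  ≡⟨ top-bestIn T k K⊆X ⟩
            firsts O (top T K)  ≡⟨ cong (firsts O) topT ⟩
            firsts O (U ∪ V)    ∎
          x≼v = firsts-≼ O (subst (x ∈_) firsts-≡ (∈-firsts⁺ O x∈)) (x∈p∪q⁺ (inj₂ v∈V))
          v≼x , v≢x = V≪U (proj₁ x∈) v∈V
      in  v≢x (O.antisym v≼x x≼v)
      where
      open ≡-Reasoning
      top-bestIn : ∀ {K} S → Block K → K ⊆ _ → top (bestIn b S) K ≡ firsts O (top S K)
      top-bestIn S = top-⟦⟧ {τ = best O (topChoice S)} b
        (best-consistent O {σ = topChoice S} (top-consistent S))

  -- Minimum and maximum for the flip order.

  ascending-flips : {S T : Construct H X} → IsConstruction S →
    Star (Flip λ x y → x ≤ y × x ≢ y) S T → S ≤flip T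
  ascending-flips c ε = ε
  ascending-flips c ((x , y , (y≤x , y≢x) , r , _) ◅ s) =
    (c , x , y , Fin.≤∧≢⇒< y≤x y≢x , r) ◅ ascending-flips (replace-construction r c) s

  -- For the reversed order a flip lifts the larger of two labels, hence goes down in the flip
  -- order; its recorded inverse `r′` goes up, and the sequence is read from its end.
  descending-flips : {S T : Construct H X} → IsConstruction S →
    Star (Flip λ x y → y ≤ x × x ≢ y) S T → T ≤flip S
  descending-flips c ε = ε
  descending-flips c ((x , y , (x≤y , y≢x) , r , r′) ◅ s) =
    descending-flips (replace-construction r c) s ◅◅
    return (replace-construction r c , y , x , Fin.≤∧≢⇒< x≤y (y≢x ∘ sym) , r′)

  ascending : IsDecTotalOrder _≡_ (_≤_ {n})
  ascending = Fin.≤-isDecTotalOrder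

  descending : IsDecTotalOrder _≡_ (flip (_≤_ {n}))
  descending = Flip.isDecTotalOrder ascending

  module _ (b : Block X) where

    bestIn-isMax : (S : Construct H X) → IsMax S (bestIn ascending b S)
    bestIn-isMax S = bestIn-constructionIn ascending b S ,
      λ p → ascending-flips (proj₁ p) (flips-to-bestIn ascending b p)

    bestIn-isMin : (S : Construct H X) → IsMin S (bestIn descending b S)
    bestIn-isMin S = bestIn-constructionIn descending b S ,
      λ p → descending-flips (proj₁ p) (flips-to-bestIn descending b p)

    -- Fusions and splits as steps of the facial weak order.

    constructionIn-facet : {S T M : Construct H X} → S FacetOf T →
                           ConstructionIn S M → ConstructionIn T M
    constructionIn-facet f (c , M⊑S) = c , M⊑S ◅◅ return f

    fusion-sameMin : {S T : Construct H X} → S ⊂[ U , V ] T → V ≺ U → SameMin S T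
    fusion-sameMin {S = S} {T} S⊂T V≺U =
      bestIn descending b S , bestIn-isMin S , subst (IsMin T) (sym min≡) (bestIn-isMin T)
      where
      min≡ : bestIn descending b S ≡ bestIn descending b T
      min≡ = bestIn-≡ descending b {S} {T} S⊂T λ u∈ v∈ → <⇒≫ (≺⇒< V≺U u∈ v∈)

    fusion-maxIncreases : {S T : Construct H X} → S ⊂[ U , V ] T → V ≺ U → MaxIncreases S T
    fusion-maxIncreases {S = S} {T} S⊂T V≺U =
      bestIn ascending b S , bestIn ascending b T , bestIn-isMax S , bestIn-isMax T , le , max≢
      where
      le : bestIn ascending b S ≤flip bestIn ascending b T
      le = proj₂ (bestIn-isMax T) (constructionIn-facet (_ , _ , S⊂T) (bestIn-constructionIn ascending b S))
      max≢ : bestIn ascending b S ≢ bestIn ascending b T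
      max≢ = bestIn-≢ ascending b {S} {T} S⊂T λ u∈ v∈ → <⇒≪ (≺⇒< V≺U u∈ v∈)

    split-sameMax : {S T : Construct H X} → T ⊂[ V , U ] S → V ≺ U → SameMax S T
    split-sameMax {S = S} {T} T⊂S V≺U =
      bestIn ascending b S , bestIn-isMax S , subst (IsMax T) max≡ (bestIn-isMax T)
      where
      max≡ : bestIn ascending b T ≡ bestIn ascending b S
      max≡ = bestIn-≡ ascending b {T} {S} T⊂S λ v∈ u∈ → <⇒≪ (≺⇒< V≺U u∈ v∈)

    split-minIncreases : {S T : Construct H X} → T ⊂[ V , U ] S → V ≺ U → MinIncreases S T
    split-minIncreases {S = S} {T} T⊂S V≺U =
      bestIn descending b S , bestIn descending b T , bestIn-isMin S , bestIn-isMin T , le , min≢ ∘ sym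
      where
      le : bestIn descending b S ≤flip bestIn descending b T
      le = proj₂ (bestIn-isMin S) (constructionIn-facet (_ , _ , T⊂S) (bestIn-constructionIn descending b T))
      min≢ : bestIn descending b T ≢ bestIn descending b S
      min≢ = bestIn-≢ descending b {T} {S} T⊂S λ v∈ u∈ → <⇒≫ (≺⇒< V≺U u∈ v∈)

    ⋖GFO⇒⋖FWO : {S T : Construct H X} → S ⋖GFO T → S ⋖FWO T
    ⋖GFO⇒⋖FWO (U , V , V≺U , inj₁ S⊂T) =
      inj₁ ((U , V , S⊂T) , fusion-sameMin S⊂T V≺U , fusion-maxIncreases S⊂T V≺U)
    ⋖GFO⇒⋖FWO (U , V , V≺U , inj₂ T⊂S) =
      inj₂ ((V , U , T⊂S) , split-sameMax T⊂S V≺U , split-minIncreases T⊂S V≺U)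

proposition5p4 : ∀ {n : ℕ} (H : Hypergraph n) → Connected H ⊤ →
    (S T : Construct H ⊤) → S ≤GFO T → S ≤FWO T
proposition5p4 H connected S T = gmap id (⋖GFO⇒⋖FWO H (⊤-nonempty , connected))
  where
  ⊤-nonempty : Nonempty ⊤
  -- The case n = 0 is excluded by S itself: its root label is non-empty.
  ⊤-nonempty = let x , _ = label-nonempty H S in x , ∈⊤
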